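{- Suppose $z\in\mathbb{Z}[i]\setminus\{0\}$ is $2$-powerfully unitarily $t$-perfect in $\mathbb{Z}[i]$ for some integer $t\ge 2$, i.e. $I_2^*(z)=t$. Then we may write $z=(1+i)^{\gamma}x$ with $\gamma$ a nonnegative integer, $x\in\mathbb{Z}[i]$ and $N(x)=x\bar x$ odd. Moreover, $x$ has exactly $\gamma+\upsilon_2(t)$ pairwise nonassociated prime divisors, where $\upsilon_2(t)$ is the exponent of $2$ in $t$.
   Context: Work in the Gaussian integers $\mathbb{Z}[i]=\mathcal O_{\mathbb{Q}(\sqrt{ -1})}$, a unique factorization domain. $|z|=\sqrt{z\bar z}$, $\arg(z)\in[0,2\pi)$. Let $A$ be the set of nonzero $z\in\mathbb{Z}[i]$ with $0\le \arg(z)<\pi/2$. Two elements are relatively prime if they have no nonunit common divisor. For nonzero $x,z$, write $x\Diamond z$ iff $x\in A$, $x\mid z$, and $x$ is relatively prime to $z/x$. For $m\in\mathbb{Z}$ define $\delta_m^*(z)=\sum_{x\Diamond z}|x|^m$ and $I_m^*(z)=\delta_m^*(z)/|z|^m$. -}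

module Defs where

open import Algebra.Bundles using (CommutativeRing; RawSemiring; Semiring)
open import Data.Empty using (⊥-elim)
open import Data.Integer.Base as ℤ using (ℤ; +_; -[1+_])
import Data.Integer.Properties as ℤ
open import Data.Integer.Tactic.RingSolver using (solve-∀)
open import Data.List.Base using (List; _++_; map; upTo; filter; cartesianProductWith)
open import Data.Nat.ListAction using (sum)
open import Data.List.Membership.Propositional using (_∈_; lose; find)
import Data.List.Membership.Propositional.Properties as ∈
import Data.List.Relation.Unary.All as All
import Data.List.Relation.Unary.Any as Any
open import Data.List.Relation.Unary.Unique.Propositional using (Unique)
import Data.List.Relation.Unary.Unique.Propositional.Properties as Unique
open import Data.Nat.Base as ℕ using (ℕ; zero; suc; z≤n; s≤s)
import Data.Nat.Divisibility as ℕ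
import Data.Nat.Properties as ℕ
open import Data.Product.Base using (Σ-syntax; ∃-syntax; _×_; _,_; proj₁; proj₂; uncurry)
open import Data.Rational.Base as ℚ using (ℚ)
open import Data.Sum.Base using (inj₁; inj₂)
open import Data.Vec.Base using (Vec)
open import Data.Vec.Relation.Unary.All using () renaming (All to VecAll)
open import Data.Vec.Relation.Unary.AllPairs using () renaming (AllPairs to VecAllPairs)
open import Data.Vec.Relation.Unary.Any using () renaming (Any to VecAny)
open import Function.Bundles using (_⇔_; mk⇔)
open import Level using (0ℓ)
open import Relation.Binary.PropositionalEquality
open import Relation.Nullary using (¬_; Dec; yes; no)
open import Relation.Nullary.Decidable using (map′; _×-dec_; _→-dec_)

infix 8 _+i_

record ℤ[i] : Set where
  constructor _+i_
  field
    re im : ℤ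

open ℤ[i] public

infixl 6 _+_
infixl 7 _*_

_+_ _*_ : ℤ[i] → ℤ[i] → ℤ[i]
(a +i b) + (c +i d) = (a ℤ.+ c) +i (b ℤ.+ d)
(a +i b) * (c +i d) = (a ℤ.* c ℤ.- b ℤ.* d) +i (a ℤ.* d ℤ.+ b ℤ.* c)

-_ conj : ℤ[i] → ℤ[i]
- (a +i b)    = (ℤ.- a) +i (ℤ.- b)
conj (a +i b) = a +i (ℤ.- b)

0# 1# 1+i : ℤ[i]
0#  = (+ 0) +i (+ 0)
1#  = (+ 1) +i (+ 0)
1+i = (+ 1) +i (+ 1)

infix 4 _≟_

_≟_ : (z w : ℤ[i]) → Dec (z ≡ w)
(a +i b) ≟ (c +i d) = map′ (uncurry (cong₂ _+i_)) (λ { refl → refl , refl }) ((a ℤ.≟ c) ×-dec (b ℤ.≟ d))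

private
  *-comm : ∀ x y → x * y ≡ y * x
  *-comm (a +i b) (c +i d) = cong₂ _+i_ (p a b c d) (q a b c d)
    where
    p : ∀ a b c d → a ℤ.* c ℤ.- b ℤ.* d ≡ c ℤ.* a ℤ.- d ℤ.* b
    p = solve-∀
    q : ∀ a b c d → a ℤ.* d ℤ.+ b ℤ.* c ≡ c ℤ.* b ℤ.+ d ℤ.* a
    q = solve-∀

  *-assoc : ∀ x y z → (x * y) * z ≡ x * (y * z)
  *-assoc (a +i b) (c +i d) (e +i f) = cong₂ _+i_ (p a b c d e f) (q a b c d e f)
    where
    p : ∀ a b c d e f →
        (a ℤ.* c ℤ.- b ℤ.* d) ℤ.* e ℤ.- (a ℤ.* d ℤ.+ b ℤ.* c) ℤ.* f ≡
        a ℤ.* (c ℤ.* e ℤ.- d ℤ.* f) ℤ.- b ℤ.* (c ℤ.* f ℤ.+ d ℤ.* e)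
    p = solve-∀
    q : ∀ a b c d e f →
        (a ℤ.* c ℤ.- b ℤ.* d) ℤ.* f ℤ.+ (a ℤ.* d ℤ.+ b ℤ.* c) ℤ.* e ≡
        a ℤ.* (c ℤ.* f ℤ.+ d ℤ.* e) ℤ.+ b ℤ.* (c ℤ.* e ℤ.- d ℤ.* f)
    q = solve-∀

  *-identityˡ : ∀ x → 1# * x ≡ x
  *-identityˡ (a +i b) = cong₂ _+i_ (p a b) (q a b)
    where
    p : ∀ a b → (+ 1) ℤ.* a ℤ.- (+ 0) ℤ.* b ≡ a
    p = solve-∀
    q : ∀ a b → (+ 1) ℤ.* b ℤ.+ (+ 0) ℤ.* a ≡ b
    q = solve-∀

  *-distribʳ-+ : ∀ x y z → (y + z) * x ≡ y * x + z * x
  *-distribʳ-+ (a +i b) (c +i d) (e +i f) = cong₂ _+i_ (p a b c d e f) (q a b c d e f)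
    where
    p : ∀ a b c d e f →
        (c ℤ.+ e) ℤ.* a ℤ.- (d ℤ.+ f) ℤ.* b ≡
        (c ℤ.* a ℤ.- d ℤ.* b) ℤ.+ (e ℤ.* a ℤ.- f ℤ.* b)
    p = solve-∀
    q : ∀ a b c d e f →
        (c ℤ.+ e) ℤ.* b ℤ.+ (d ℤ.+ f) ℤ.* a ≡
        (c ℤ.* b ℤ.+ d ℤ.* a) ℤ.+ (e ℤ.* b ℤ.+ f ℤ.* a)
    q = solve-∀

  +-comm : ∀ x y → x + y ≡ y + x
  +-comm (a +i b) (c +i d) = cong₂ _+i_ (ℤ.+-comm a c) (ℤ.+-comm b d)

commutativeRing : CommutativeRing 0ℓ 0ℓ
commutativeRing = record
  { Carrier = ℤ[i] ; _≈_ = _≡_ ; _+_ = _+_ ; _*_ = _*_ ; -_ = -_ ; 0# = 0# ; 1# = 1#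
  ; isCommutativeRing = record
    { isRing = record
      { +-isAbelianGroup = record
        { isGroup = record
          { isMonoid = record
            { isSemigroup = record
              { isMagma = record { isEquivalence = isEquivalence ; ∙-cong = cong₂ _+_ }
              ; assoc   = λ { (a +i b) (c +i d) (e +i f) →
                              cong₂ _+i_ (ℤ.+-assoc a c e) (ℤ.+-assoc b d f) } }
            ; identity = (λ { (a +i b) → cong₂ _+i_ (ℤ.+-identityˡ a) (ℤ.+-identityˡ b) })
                       , (λ { (a +i b) → cong₂ _+i_ (ℤ.+-identityʳ a) (ℤ.+-identityʳ b) }) }
          ; inverse = (λ { (a +i b) → cong₂ _+i_ (ℤ.+-inverseˡ a) (ℤ.+-inverseˡ b) })
                    , (λ { (a +i b) → cong₂ _+i_ (ℤ.+-inverseʳ a) (ℤ.+-inverseʳ b) })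
          ; ⁻¹-cong = cong -_ }
        ; comm = +-comm }
      ; *-cong     = cong₂ _*_
      ; *-assoc    = *-assoc
      ; *-identity = *-identityˡ , (λ x → trans (*-comm x 1#) (*-identityˡ x))
      ; distrib    = (λ x y z → trans (*-comm x (y + z))
                       (trans (*-distribʳ-+ x y z) (cong₂ _+_ (*-comm y x) (*-comm z x))))
                   , *-distribʳ-+ }
    ; *-comm = *-comm } }

private module R = CommutativeRing commutativeRing

rawSemiring : RawSemiring 0ℓ 0ℓ
rawSemiring = Semiring.rawSemiring R.semiring

open import Algebra.Definitions.RawSemiring rawSemiring public
  using (_∣_; _^_; Coprime; Prime)
-- the fields of `x ∣ y` are `quotient` and `equality : quotient * x ≡ y`
open import Algebra.Definitions.RawMagma (RawSemiring.*-rawMagma rawSemiring) public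
  using () renaming (module _∣ʳ_ to ∣)
open import Algebra.Definitions.RawMagma (RawSemiring.*-rawMagma rawSemiring)
  using (_,_)

Associated : ℤ[i] → ℤ[i] → Set
Associated x y = ∃[ u ] u ∣ 1# × x ≡ u * y

-- N(z) = z z̄ = |z|²; see z*conj[z]≡norm[z]
norm : ℤ[i] → ℕ
norm (a +i b) = ℤ.∣ a ∣ ℕ.* ℤ.∣ a ∣ ℕ.+ ℤ.∣ b ∣ ℕ.* ℤ.∣ b ∣

private
  +∣a∣² : ∀ a → + (ℤ.∣ a ∣ ℕ.* ℤ.∣ a ∣) ≡ a ℤ.* a
  +∣a∣² (+ n)    = ℤ.pos-* n n
  +∣a∣² -[1+ n ] = refl

  +norm : ∀ z → + norm z ≡ re z ℤ.* re z ℤ.+ im z ℤ.* im z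
  +norm (a +i b) = cong₂ ℤ._+_ (+∣a∣² a) (+∣a∣² b)

z*conj[z]≡norm[z] : ∀ z → z * conj z ≡ (+ norm z) +i (+ 0)
z*conj[z]≡norm[z] z@(a +i b) = cong₂ _+i_ (trans (p a b) (sym (+norm z))) (q a b)
  where
  p : ∀ a b → a ℤ.* a ℤ.- b ℤ.* (ℤ.- b) ≡ a ℤ.* a ℤ.+ b ℤ.* b
  p = solve-∀
  q : ∀ a b → a ℤ.* (ℤ.- b) ℤ.+ b ℤ.* a ≡ + 0
  q = solve-∀

norm-* : ∀ z w → norm (z * w) ≡ norm z ℕ.* norm w
norm-* z@(a +i b) w@(c +i d) = ℤ.+-injective (begin
  + norm (z * w)                          ≡⟨ +norm (z * w) ⟩
  re (z * w) ℤ.* re (z * w) ℤ.+ im (z * w) ℤ.* im (z * w) ≡⟨ p a b c d ⟩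
  (a ℤ.* a ℤ.+ b ℤ.* b) ℤ.* (c ℤ.* c ℤ.+ d ℤ.* d) ≡⟨ cong₂ ℤ._*_ (+norm z) (+norm w) ⟨
  + norm z ℤ.* + norm w                   ≡⟨ ℤ.pos-* (norm z) (norm w) ⟨
  + (norm z ℕ.* norm w)                   ∎)
  where
  open ≡-Reasoning
  p : ∀ a b c d →
      (a ℤ.* c ℤ.- b ℤ.* d) ℤ.* (a ℤ.* c ℤ.- b ℤ.* d) ℤ.+ (a ℤ.* d ℤ.+ b ℤ.* c) ℤ.* (a ℤ.* d ℤ.+ b ℤ.* c) ≡
      (a ℤ.* a ℤ.+ b ℤ.* b) ℤ.* (c ℤ.* c ℤ.+ d ℤ.* d)
  p = solve-∀

norm≡0⇒≡0 : ∀ z → norm z ≡ 0 → z ≡ 0#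
norm≡0⇒≡0 (a +i b) eq = cong₂ _+i_
  (go a (ℕ.m+n≡0⇒m≡0 _ eq))
  (go b (ℕ.m+n≡0⇒n≡0 (ℤ.∣ a ∣ ℕ.* ℤ.∣ a ∣) eq))
  where
  go : ∀ a → ℤ.∣ a ∣ ℕ.* ℤ.∣ a ∣ ≡ 0 → a ≡ + 0
  go (+ zero) _ = refl

norm-nonZero : ∀ {z} → z ≢ 0# → ℕ.NonZero (norm z)
norm-nonZero z≢0 = ℕ.≢-nonZero (λ eq → z≢0 (norm≡0⇒≡0 _ eq))

*-cancelʳ : ∀ x {p q} → x ≢ 0# → p * x ≡ q * x → p ≡ q
*-cancelʳ x {p} {q} x≢0 eq = begin
  p                ≡⟨ R.+-identityʳ p ⟨
  p + 0#           ≡⟨ cong (λ w → p + w) (R.-‿inverseˡ q) ⟨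
  p + (- q + q)    ≡⟨ R.+-assoc p (- q) q ⟨
  (p + - q) + q    ≡⟨ cong (_+ q) p-q≡0 ⟩
  0# + q           ≡⟨ R.+-identityˡ q ⟩
  q                ∎
  where
  open ≡-Reasoning
  [p-q]x≡0 : (p + - q) * x ≡ 0#
  [p-q]x≡0 = begin
    (p + - q) * x       ≡⟨ *-distribʳ-+ x p (- q) ⟩
    p * x + (- q) * x   ≡⟨ cong (_+ (- q) * x) eq ⟩
    q * x + (- q) * x   ≡⟨ *-distribʳ-+ x q (- q) ⟨
    (q + - q) * x       ≡⟨ cong (_* x) (R.-‿inverseʳ q) ⟩
    0# * x              ≡⟨ R.zeroˡ x ⟩
    0#                  ∎
  p-q≡0 : p + - q ≡ 0#
  p-q≡0 with ℕ.m*n≡0⇒m≡0∨n≡0 (norm (p + - q)) (trans (sym (norm-* (p + - q) x)) (cong norm [p-q]x≡0))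
  ... | inj₁ e = norm≡0⇒≡0 _ e
  ... | inj₂ e = ⊥-elim (x≢0 (norm≡0⇒≡0 x e))

private
  interval : ℕ → List ℤ
  interval n = map +_ (upTo (suc n)) ++ map -[1+_] (upTo n)

  ∈-interval : ∀ {n} a → ℤ.∣ a ∣ ℕ.≤ n → a ∈ interval n
  ∈-interval {n} (+ k)    k≤n = ∈.∈-++⁺ˡ (∈.∈-map⁺ +_ (∈.∈-upTo⁺ (s≤s k≤n)))
  ∈-interval {n} -[1+ k ] k<n = ∈.∈-++⁺ʳ (map +_ (upTo (suc n))) (∈.∈-map⁺ -[1+_] (∈.∈-upTo⁺ k<n))

  interval-unique : ∀ n → Unique (interval n)
  interval-unique n = Unique.++⁺
    (Unique.map⁺ ℤ.+-injective (Unique.upTo⁺ (suc n)))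
    (Unique.map⁺ ℤ.-[1+-injective (Unique.upTo⁺ n))
    disjoint
    where
    disjoint : ∀ {a} → ¬ (a ∈ map +_ (upTo (suc n)) × a ∈ map -[1+_] (upTo n))
    disjoint (p , q) with ∈.∈-map⁻ +_ p | ∈.∈-map⁻ -[1+_] q
    ... | _ , _ , refl | _ , _ , ()

-- contains every w with norm w ≤ n, but also the corners of the square
box : ℕ → List ℤ[i]
box n = cartesianProductWith _+i_ (interval n) (interval n)

private
  m≤m*m : ∀ m → m ℕ.≤ m ℕ.* m
  m≤m*m zero    = z≤n
  m≤m*m (suc m) = ℕ.m≤m*n (suc m) (suc m)

∈-box : ∀ {n} w → norm w ℕ.≤ n → w ∈ box n
∈-box (a +i b) le = ∈.∈-cartesianProductWith⁺ _+i_
  (∈-interval a (ℕ.≤-trans (m≤m*m ℤ.∣ a ∣) (ℕ.≤-trans (ℕ.m≤m+n _ _) le)))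
  (∈-interval b (ℕ.≤-trans (m≤m*m ℤ.∣ b ∣) (ℕ.≤-trans (ℕ.m≤n+m _ (ℤ.∣ a ∣ ℕ.* ℤ.∣ a ∣)) le)))

box-unique : ∀ n → Unique (box n)
box-unique n = Unique.cartesianProductWith⁺ _+i_ (λ { refl → refl , refl })
  (interval-unique n) (interval-unique n)

∣⇒norm≤ : ∀ {w z} → z ≢ 0# → w ∣ z → norm w ℕ.≤ norm z
∣⇒norm≤ {w} z≢0 (q , refl) = subst (norm w ℕ.≤_) (sym (norm-* q w)) (ℕ.m≤n*m (norm w) (norm q))
  where instance
  _ : ℕ.NonZero (norm q)
  _ = norm-nonZero {q} (λ { refl → z≢0 (R.zeroˡ w) })

infix 5 _∣?_

_∣?_ : ∀ x y → Dec (x ∣ y)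
x ∣? y with y ≟ 0#
... | yes refl = yes (0# , R.zeroˡ x)
... | no y≢0   = map′
  (λ a → let q , _ , eq = find a in q , eq)
  (λ { (q , eq) → lose (∈-box q (∣⇒norm≤ y≢0 (x , trans (*-comm x q) eq))) eq })
  (Any.any? (λ q → q * x ≟ y) (box (norm y)))

coprime? : ∀ x y → x ≢ 0# → Dec (Coprime x y)
coprime? x y x≢0 = map′
  (λ all {w} w∣x → All.lookup all (∈-box w (∣⇒norm≤ x≢0 w∣x)) w∣x)
  (λ cop → All.tabulate (λ _ → cop))
  (All.all? (λ w → w ∣? x →-dec (w ∣? y →-dec w ∣? 1#)) (box (norm x)))

-- the nonzero z with 0 ≤ arg z < π/2: the positive real axis is included, the imaginary axis is not
A : ℤ[i] → Set
A z = (+ 0) ℤ.< re z × (+ 0) ℤ.≤ im z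

A⇒≢0 : ∀ {z} → A z → z ≢ 0#
A⇒≢0 (ℤ.+<+ () , _) refl

infix 4 _◇_ _◇?_

_◇_ : ℤ[i] → ℤ[i] → Set
x ◇ z = A x × Σ[ x∣z ∈ x ∣ z ] Coprime x (∣.quotient x∣z)

_◇?_ : ∀ x z → Dec (x ◇ z)
x ◇? z with (+ 0) ℤ.<? re x ×-dec (+ 0) ℤ.≤? im x
... | no ¬A = no (λ d → ¬A (proj₁ d))
... | yes Ax with x ∣? z
...   | no x∤z = no (λ d → x∤z (proj₁ (proj₂ d)))
...   | yes (q , eq) with coprime? x q (A⇒≢0 Ax)
...     | yes cop = yes (Ax , (q , eq) , λ {w} → cop {w})
...     | no ¬cop = no (λ { (_ , (q′ , eq′) , cop) →
            ¬cop (λ {w} w∣x w∣q → cop {w} w∣x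
              (subst (w ∣_) (*-cancelʳ x (A⇒≢0 Ax) (trans eq (sym eq′))) w∣q)) })

-- the enumeration is complete only for z ≢ 0; see ∈-unitaryDivisors and
-- unitaryDivisors-unique
unitaryDivisors : ℤ[i] → List ℤ[i]
unitaryDivisors z = filter (_◇? z) (box (norm z))

∈-unitaryDivisors : ∀ {x z} → z ≢ 0# → x ∈ unitaryDivisors z ⇔ x ◇ z
∈-unitaryDivisors {x} {z} z≢0 = mk⇔
  (λ x∈ → proj₂ (∈.∈-filter⁻ (_◇? z) {xs = box (norm z)} x∈))
  (λ d → ∈.∈-filter⁺ (_◇? z) (∈-box x (∣⇒norm≤ z≢0 (proj₁ (proj₂ d)))) d)

unitaryDivisors-unique : ∀ z → Unique (unitaryDivisors z)
unitaryDivisors-unique z = Unique.filter⁺ (_◇? z) (box-unique (norm z))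

-- |x|² = norm x is a natural number, so the exponent-2 case of the divisor
-- functions needs no real numbers
δ₂* : ℤ[i] → ℕ
δ₂* z = sum (map norm (unitaryDivisors z))

I₂* : (z : ℤ[i]) → .(z ≢ 0#) → ℚ
I₂* z z≢0 = ℚ._/_ (+ δ₂* z) (norm z) {{norm-nonZero {z} z≢0}}

-- "exactly n pairwise nonassociated prime divisors": ps is a full set of
-- representatives for the prime divisors of x up to units
HasExactlyPrimeDivisors : ℕ → ℤ[i] → Set
HasExactlyPrimeDivisors n x = Σ[ ps ∈ Vec ℤ[i] n ]
    VecAll (λ p → Prime p × p ∣ x) ps
  × VecAllPairs (λ p q → ¬ Associated p q) ps
  × (∀ q → Prime q → q ∣ x → VecAny (Associated q) ps)

-- the largest e ≤ b with 2 ^ e ∣ t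
υ₂-upTo : ℕ → ℕ → ℕ
υ₂-upTo zero    t = 0
υ₂-upTo (suc b) t with 2 ℕ.^ suc b ℕ.∣? t
... | yes _ = suc b
... | no  _ = υ₂-upTo b t

-- for t ≠ 0 the bound is harmless, since 2 ^ e ∣ t forces e < t
υ₂ : ℕ → ℕ
υ₂ t = υ₂-upTo t t

module Submission where

-- Let δ = δ₂*.  Stripping off a prime is multiplicative: δ(pᵏ y) = (1 + N(p)ᵏ) δ(y) for k ≥ 1
-- and p prime not dividing y, since the unitary divisors of pᵏ y are those of y together with
-- the first-quadrant associates of pᵏ d for d a unitary divisor of y.  An odd norm is 1 mod 4,
-- so each odd prime contributes exactly one factor 2 to δ(z), whereas 1 + 2^γ is odd.
-- Comparing the powers of 2 in δ(z) = t N(z) = t 2^γ N(x) gives the count.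

open import Defs
open import Data.Integer.Base using (+_)
open import Data.Nat.Base as ℕ using (ℕ)
open import Data.Nat.Divisibility as ℕ using (_∤_)
open import Data.Product.Base using (∃-syntax; _×_)
open import Data.Rational.Base as ℚ using (_/_)
open import Relation.Binary.PropositionalEquality using (_≡_; _≢_)

open import Algebra.Bundles using (CommutativeRing)
open import Algebra.Definitions.RawMagma (CommutativeRing.*-rawMagma commutativeRing) using (_,_)
import Algebra.Properties.Ring (CommutativeRing.ring commutativeRing) as Ring
open import Data.Integer.Base as ℤ using (ℤ; -[1+_])
import Data.Integer.DivMod as ℤ
import Data.Integer.Properties as ℤ
import Data.Integer.Tactic.RingSolver as ℤ
open import Data.List.Base using ([]; _∷_; _++_; map)
open import Data.List.Membership.Propositional using (_∈_; find; lose)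
import Data.List.Membership.Propositional.Properties as ∈
open import Data.List.Membership.Propositional.Properties.WithK using (unique∧set⇒bag)
open import Data.List.Properties using (map-++)
open import Data.List.Relation.Binary.BagAndSetEquality using (∼bag⇒↭)
open import Data.List.Relation.Binary.Permutation.Propositional using (_↭_)
import Data.List.Relation.Binary.Permutation.Propositional.Properties as ↭
open import Data.List.Relation.Unary.All as All using (All; []; _∷_)
import Data.List.Relation.Unary.All.Properties as All
open import Data.List.Relation.Unary.AllPairs using ([]; _∷_)
open import Data.List.Relation.Unary.Any as Any using (here)
open import Data.List.Relation.Unary.Unique.Propositional using (Unique)
import Data.List.Relation.Unary.Unique.Propositional.Properties as Unique
open import Data.Nat.Base using (zero; suc; z≤n; s≤s)
open import Data.Nat.Induction using (<-wellFounded)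
open import Data.Nat.ListAction using (sum)
open import Data.Nat.ListAction.Properties using (sum-++; sum-↭)
open import Data.Nat.Primality using (euclidsLemma; prime[2])
import Data.Nat.Properties as ℕ
import Data.Nat.Tactic.RingSolver as ℕ
open import Data.Product.Base using (_,_; proj₁; proj₂)
import Data.Rational.Properties as ℚ
open import Data.Sum.Base using (_⊎_; inj₁; inj₂; [_,_]′)
open import Data.Vec.Base using ([]; _∷_)
open import Data.Vec.Relation.Unary.All as VecAll using ([]; _∷_)
open import Data.Vec.Relation.Unary.AllPairs using ([]; _∷_)
open import Data.Vec.Relation.Unary.Any using (here; there)
open import Function.Bundles using (mk⇔; Equivalence)
open import Induction.WellFounded using (Acc; acc)
open import Relation.Binary.PropositionalEquality
  using (refl; sym; trans; cong; cong₂; subst; module ≡-Reasoning)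
open import Relation.Nullary using (¬_; yes; no; contradiction)
open import Relation.Nullary.Decidable using (_×-dec_; ¬?)

-- A `Prime` is a nonzero nonunit that divides a factor of every product it divides, so every
-- argument that cancels or compares primes is immediate. The Euclidean algorithm serves for the
-- other half of factorization: a nonunit has some prime divisor, namely a nonunit divisor below
-- which no further divisor of smaller norm is a nonunit. The obstacle in the stripping step is the
-- choice of associates. Unitary divisors live in `A`, and multiplication by pᵏ leaves `A`, so each
-- product is turned back by a unit while its cofactor is turned by the inverse unit. Norms do not
-- see these units, hence neither does δ.

private
  module R = CommutativeRing commutativeRing

-- Restated with the operations of Defs: through the projections of the bundle, products would be
-- compared componentwise, at exponential cost.
*-comm : ∀ x y → x * y ≡ y * x
*-comm = R.*-comm

*-assoc : ∀ x y z → x * y * z ≡ x * (y * z)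
*-assoc = R.*-assoc

*-identityˡ : ∀ x → 1# * x ≡ x
*-identityˡ = R.*-identityˡ

*-distribˡ-+ : ∀ x y z → x * (y + z) ≡ x * y + x * z
*-distribˡ-+ = R.distribˡ

*-distribʳ-+ : ∀ x y z → (y + z) * x ≡ y * x + z * x
*-distribʳ-+ = R.distribʳ

*-zeroˡ : ∀ x → 0# * x ≡ 0#
*-zeroˡ = R.zeroˡ

*-zeroʳ : ∀ x → x * 0# ≡ 0#
*-zeroʳ = R.zeroʳ

+-comm : ∀ x y → x + y ≡ y + x
+-comm = R.+-comm

+-assoc : ∀ x y z → x + y + z ≡ x + (y + z)
+-assoc = R.+-assoc

+-cancelʳ : ∀ x y → (x + y) + - y ≡ x
+-cancelʳ x y = trans (R.+-assoc x y (- y)) (trans (cong (λ s → x + s) (R.-‿inverseʳ y)) (R.+-identityʳ x))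

-‿distribˡ-* : ∀ x y → - (x * y) ≡ - x * y
-‿distribˡ-* = Ring.-‿distribˡ-*

-- Divisibility, norms and units

x∙yz≡y∙xz : ∀ x y z → x * (y * z) ≡ y * (x * z)
x∙yz≡y∙xz x y z = trans (sym (*-assoc x y z)) (trans (cong (_* z) (*-comm x y)) (*-assoc y x z))

∣-refl : ∀ {x} → x ∣ x
∣-refl {x} = 1# , *-identityˡ x

∣-trans : ∀ {x y z} → x ∣ y → y ∣ z → x ∣ z
∣-trans {x} (p , refl) (q , refl) = q * p , *-assoc q p x

∣n⇒∣m*n : ∀ {x} z {y} → x ∣ y → x ∣ z * y
∣n⇒∣m*n z x∣y = ∣-trans x∣y (z , refl)

m∣m*n : ∀ x y → x ∣ x * y
m∣m*n x y = y , *-comm y x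

norm-conj : ∀ z → norm (conj z) ≡ norm z
norm-conj (a +i b) = cong (λ n → ℤ.∣ a ∣ ℕ.* ℤ.∣ a ∣ ℕ.+ n ℕ.* n) (ℤ.∣-i∣≡∣i∣ b)

∣1⇒norm≡1 : ∀ {u} → u ∣ 1# → norm u ≡ 1
∣1⇒norm≡1 {u} (v , eq) = ℕ.m*n≡1⇒n≡1 (norm v) (norm u) (trans (sym (norm-* v u)) (cong norm eq))

conj-inverse : ∀ {u} → norm u ≡ 1 → conj u * u ≡ 1#
conj-inverse {u} eq = trans (*-comm (conj u) u)
  (trans (z*conj[z]≡norm[z] u) (cong (λ n → (+ n) +i (+ 0)) eq))

norm≡1⇒∣1 : ∀ {u} → norm u ≡ 1 → u ∣ 1#
norm≡1⇒∣1 {u} eq = conj u , conj-inverse {u} eq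

*≢0 : ∀ {x y} → x ≢ 0# → y ≢ 0# → x * y ≢ 0#
*≢0 {x} {y} x≢0 y≢0 xy≡0 = x≢0 (*-cancelʳ y y≢0 (trans xy≡0 (sym (*-zeroˡ y))))

*≢0⇒ˡ≢0 : ∀ {x y} → x * y ≢ 0# → x ≢ 0#
*≢0⇒ˡ≢0 {y = y} xy≢0 refl = xy≢0 (*-zeroˡ y)

*≢0⇒ʳ≢0 : ∀ {x y} → x * y ≢ 0# → y ≢ 0#
*≢0⇒ʳ≢0 {x} xy≢0 refl = xy≢0 (*-zeroʳ x)

-- Euclidean division

∣r-n∣≤n : ∀ {r n} → r ℕ.≤ n ℕ.+ n → ℤ.∣ + r ℤ.- + n ∣ ℕ.≤ n
∣r-n∣≤n {r} {n} r≤2n with ℕ.≤-total r n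
... | inj₁ r≤n = subst (ℕ._≤ n) (sym (trans (cong ℤ.∣_∣ (ℤ.m-n≡m⊖n r n)) (ℤ.∣⊖∣-≤ r≤n))) (ℕ.m∸n≤m n r)
... | inj₂ n≤r = subst (ℕ._≤ n) (sym (cong ℤ.∣_∣ (trans (ℤ.m-n≡m⊖n r n) (ℤ.⊖-≥ n≤r))))
                   (ℕ.m≤n+o⇒m∸n≤o r n r≤2n)

-- Dividing 2a + n by 2n rounds a / n to a nearest integer q: the remainder r satisfies r - n = 2(a
-- - qn), and 0 ≤ r < 2n bounds the absolute value by n.
nearest-multiple : ∀ a n .{{_ : ℕ.NonZero n}} → ∃[ q ] 2 ℕ.* ℤ.∣ a ℤ.- q ℤ.* + n ∣ ℕ.≤ n
nearest-multiple a n = q , subst (ℕ._≤ n) ∣r-n∣≡ (∣r-n∣≤n (ℕ.<⇒≤ (ℤ.n%ℕd<d a′ (n ℕ.+ n))))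
  where
  instance
    _ : ℕ.NonZero (n ℕ.+ n)
    _ = ℕ.>-nonZero (ℕ.≤-trans (ℕ.>-nonZero⁻¹ n) (ℕ.m≤m+n n n))
  a′ = a ℤ.+ a ℤ.+ + n
  q  = a′ ℤ./ℕ (n ℕ.+ n)
  r  = a′ ℤ.%ℕ (n ℕ.+ n)
  rearrange : ∀ a n q r → a ℤ.+ a ℤ.+ n ≡ r ℤ.+ q ℤ.* (n ℤ.+ n) →
              r ℤ.- n ≡ + 2 ℤ.* (a ℤ.- q ℤ.* n)
  rearrange a n q r eq = begin
    r ℤ.- n                                             ≡⟨ p r n q ⟩
    (r ℤ.+ q ℤ.* (n ℤ.+ n)) ℤ.- q ℤ.* (n ℤ.+ n) ℤ.- n   ≡⟨ cong (λ s → s ℤ.- q ℤ.* (n ℤ.+ n) ℤ.- n) eq ⟨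
    (a ℤ.+ a ℤ.+ n) ℤ.- q ℤ.* (n ℤ.+ n) ℤ.- n           ≡⟨ p′ a n q ⟩
    + 2 ℤ.* (a ℤ.- q ℤ.* n)                             ∎
    where
    open ≡-Reasoning
    p : ∀ r n q → r ℤ.- n ≡ (r ℤ.+ q ℤ.* (n ℤ.+ n)) ℤ.- q ℤ.* (n ℤ.+ n) ℤ.- n
    p = ℤ.solve-∀
    p′ : ∀ a n q → (a ℤ.+ a ℤ.+ n) ℤ.- q ℤ.* (n ℤ.+ n) ℤ.- n ≡ + 2 ℤ.* (a ℤ.- q ℤ.* n)
    p′ = ℤ.solve-∀
  ∣r-n∣≡ : ℤ.∣ + r ℤ.- + n ∣ ≡ 2 ℕ.* ℤ.∣ a ℤ.- q ℤ.* + n ∣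
  ∣r-n∣≡ = trans
    (cong ℤ.∣_∣ (rearrange a (+ n) q (+ r)
      (trans (ℤ.a≡a%ℕn+[a/ℕn]*n a′ (n ℕ.+ n)) (cong (λ s → + r ℤ.+ q ℤ.* s) (ℤ.pos-+ n n)))))
    (ℤ.abs-* (+ 2) (a ℤ.- q ℤ.* + n))

-- Rounding w / z = w z̄ / N(z) to a nearest Gaussian integer q leaves an error
-- e with N(e) N(z) = N(e z̄) ≤ N(z)² / 2.
division : ∀ w z → z ≢ 0# → ∃[ q ] norm (w + q * z) ℕ.< norm z
division w z z≢0 = q , ℕ.≰⇒> λ n≤m → contradiction (ℕ.*-cancelʳ-≤ 4 2 n (begin
  4 ℕ.* n      ≤⟨ ℕ.*-monoʳ-≤ 4 n≤m ⟩
  4 ℕ.* norm e ≤⟨ ℕ.*-cancelʳ-≤ (4 ℕ.* norm e) (2 ℕ.* n) n bound ⟩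
  2 ℕ.* n      ∎)) λ { (s≤s (s≤s ())) }
  where
  open ℕ.≤-Reasoning
  n = norm z
  instance
    _ : ℕ.NonZero n
    _ = norm-nonZero {z} z≢0
  c = w * conj z
  qa = nearest-multiple (re c) n
  qb = nearest-multiple (im c) n
  q = (ℤ.- proj₁ qa) +i (ℤ.- proj₁ qb)
  e = w + q * z
  e*conj[z] : e * conj z ≡ (re c ℤ.- proj₁ qa ℤ.* + n) +i (im c ℤ.- proj₁ qb ℤ.* + n)
  e*conj[z] = trans (*-distribʳ-+ (conj z) w (q * z))
    (trans (cong (λ s → c + s) (trans (*-assoc q z (conj z)) (cong (q *_) (z*conj[z]≡norm[z] z))))
      (cong₂ _+i_ (r (re c) (proj₁ qa) (proj₁ qb) (+ n)) (s (im c) (proj₁ qa) (proj₁ qb) (+ n))))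
    where
    r : ∀ c a b n → c ℤ.+ ((ℤ.- a) ℤ.* n ℤ.- (ℤ.- b) ℤ.* + 0) ≡ c ℤ.- a ℤ.* n
    r = ℤ.solve-∀
    s : ∀ c a b n → c ℤ.+ ((ℤ.- a) ℤ.* + 0 ℤ.+ (ℤ.- b) ℤ.* n) ≡ c ℤ.- b ℤ.* n
    s = ℤ.solve-∀
  bound : 4 ℕ.* norm e ℕ.* n ℕ.≤ 2 ℕ.* n ℕ.* n
  bound = begin
    4 ℕ.* norm e ℕ.* n                ≡⟨ ℕ.*-assoc 4 (norm e) n ⟩
    4 ℕ.* (norm e ℕ.* n)              ≡⟨ cong (λ s → 4 ℕ.* (norm e ℕ.* s)) (norm-conj z) ⟨
    4 ℕ.* (norm e ℕ.* norm (conj z))  ≡⟨ cong (4 ℕ.*_) (norm-* e (conj z)) ⟨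
    4 ℕ.* norm (e * conj z)           ≡⟨ cong (λ s → 4 ℕ.* norm s) e*conj[z] ⟩
    4 ℕ.* (x ℕ.* x ℕ.+ y ℕ.* y)       ≡⟨ p x y ⟩
    (2 ℕ.* x) ℕ.* (2 ℕ.* x) ℕ.+ (2 ℕ.* y) ℕ.* (2 ℕ.* y)
      ≤⟨ ℕ.+-mono-≤ (ℕ.*-mono-≤ (proj₂ qa) (proj₂ qa)) (ℕ.*-mono-≤ (proj₂ qb) (proj₂ qb)) ⟩
    n ℕ.* n ℕ.+ n ℕ.* n               ≡⟨ p′ n ⟩
    2 ℕ.* n ℕ.* n                     ∎
    where
    x = ℤ.∣ re c ℤ.- proj₁ qa ℤ.* + n ∣
    y = ℤ.∣ im c ℤ.- proj₁ qb ℤ.* + n ∣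
    p : ∀ x y → 4 ℕ.* (x ℕ.* x ℕ.+ y ℕ.* y) ≡ (2 ℕ.* x) ℕ.* (2 ℕ.* x) ℕ.+ (2 ℕ.* y) ℕ.* (2 ℕ.* y)
    p = ℕ.solve-∀
    p′ : ∀ n → n ℕ.* n ℕ.+ n ℕ.* n ≡ 2 ℕ.* n ℕ.* n
    p′ = ℕ.solve-∀

∣-linear : ∀ {g x y} a b → g ∣ x → g ∣ y → g ∣ a * x + b * y
∣-linear {g} a b (q , refl) (r , refl) = a * q + b * r ,
  trans (*-distribʳ-+ g (a * q) (b * r)) (cong₂ _+_ (*-assoc a q g) (*-assoc b r g))

∣-+-cancelʳ : ∀ {g} x {y} → g ∣ x + y → g ∣ y → g ∣ x
∣-+-cancelʳ {g} x {y} (q , qg≡x+y) (r , rg≡y) = q + - r , (begin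
  (q + - r) * g       ≡⟨ *-distribʳ-+ g q (- r) ⟩
  q * g + - r * g     ≡⟨ cong₂ _+_ qg≡x+y (trans (sym (-‿distribˡ-* r g)) (cong -_ rg≡y)) ⟩
  (x + y) + - y       ≡⟨ +-cancelʳ x y ⟩
  x                   ∎)
  where open ≡-Reasoning

-- Bézout's identity and the existence of prime divisors

Bézout : ℤ[i] → ℤ[i] → Set
Bézout x y = ∃[ g ] g ∣ x × g ∣ y × ∃[ a ] ∃[ b ] g ≡ a * x + b * y

bézout-0 : ∀ x → Bézout x 0#
bézout-0 x = x , ∣-refl , (0# , *-zeroˡ x) , 1# , 0# ,
  sym (trans (cong₂ _+_ (*-identityˡ x) (*-zeroˡ 0#)) (R.+-identityʳ x))

bézout-step : ∀ x q y → Bézout y (x + q * y) → Bézout x y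
bézout-step x q y (g , g∣y , g∣r , a , b , g≡) =
  g , ∣-+-cancelʳ x g∣r (∣n⇒∣m*n q g∣y) , g∣y , b , b * q + a , trans g≡ (begin
    a * y + b * (x + q * y)         ≡⟨ +-comm (a * y) (b * (x + q * y)) ⟩
    b * (x + q * y) + a * y         ≡⟨ cong (_+ a * y) (*-distribˡ-+ b x (q * y)) ⟩
    b * x + b * (q * y) + a * y     ≡⟨ +-assoc (b * x) (b * (q * y)) (a * y) ⟩
    b * x + (b * (q * y) + a * y)   ≡⟨ cong (λ s → b * x + (s + a * y)) (*-assoc b q y) ⟨
    b * x + (b * q * y + a * y)     ≡⟨ cong (λ s → b * x + s) (*-distribʳ-+ y (b * q) a) ⟨
    b * x + (b * q + a) * y         ∎)
  where open ≡-Reasoning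

bézout : ∀ x y → Bézout x y
bézout x y = go x y (<-wellFounded (norm y))
  where
  go : ∀ x y → Acc ℕ._<_ (norm y) → Bézout x y
  go x y (acc rec) with y ≟ 0#
  ... | yes refl = bézout-0 x
  ... | no y≢0   = let q , r<y = division x y y≢0 in bézout-step x q y (go y (x + q * y) (rec r<y))

-- Multiplying g = ap + bx by y gives two terms divisible by p, and the unit g can be divided out.
bézout-unit⇒∣ : ∀ {p g x y} a b → g ≡ a * p + b * x → g ∣ 1# → p ∣ x * y → p ∣ y
bézout-unit⇒∣ {p} {g} {x} {y} a b g≡ (h , hg≡1) p∣xy =
  subst (p ∣_) h*g*y≡y (∣n⇒∣m*n h (subst (p ∣_) (sym g*y≡) (∣-linear a b (m∣m*n p y) p∣xy)))
  where
  g*y≡ : g * y ≡ a * (p * y) + b * (x * y)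
  g*y≡ = trans (cong (_* y) g≡)
    (trans (*-distribʳ-+ y (a * p) (b * x)) (cong₂ _+_ (*-assoc a p y) (*-assoc b x y)))
  h*g*y≡y : h * (g * y) ≡ y
  h*g*y≡y = trans (sym (*-assoc h g y)) (trans (cong (_* y) hg≡1) (*-identityˡ y))

unit*-∣ : ∀ {k x y} → k ∣ 1# → x ∣ y → k * x ∣ y
unit*-∣ {k} {x} (h , hk≡1) = ∣-trans (h , (begin
  h * (k * x) ≡⟨ *-assoc h k x ⟨
  h * k * x   ≡⟨ cong (_* x) hk≡1 ⟩
  1# * x      ≡⟨ *-identityˡ x ⟩
  x           ∎))
  where open ≡-Reasoning

norm≤1⇒≡1 : ∀ {k} → k ≢ 0# → norm k ℕ.≤ 1 → norm k ≡ 1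
norm≤1⇒≡1 {k} k≢0 k≤1 = ℕ.≤-antisym k≤1 (ℕ.>-nonZero⁻¹ (norm k) {{norm-nonZero {k} k≢0}})

-- Let p divide xy and let g be a greatest common divisor of p and x. If g is a unit, Bézout gives p
-- ∣ y. Otherwise minimality gives g at least the norm of p, so the cofactor k of g in p is a unit
-- and p divides x along with g.
minimal-nonunit⇒prime : ∀ {p} → p ≢ 0# → ¬ p ∣ 1# →
  (∀ w → w ∣ p → norm w ≢ 1 → norm p ℕ.≤ norm w) → Prime p
minimal-nonunit⇒prime {p} p≢0 p∤1 minimal = record
  { p≉0 = p≢0 ; p∤1 = p∤1 ; split-∣ = λ {x} {y} p∣xy → split x y p∣xy (bézout p x) }
  where
  split : ∀ x y → p ∣ x * y → Bézout p x → p ∣ x ⊎ p ∣ y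
  split x y p∣xy (g , (k , kg≡p) , g∣x , a , b , g≡) with norm g ℕ.≟ 1
  ... | yes norm[g]≡1 = inj₂ (bézout-unit⇒∣ a b g≡ (norm≡1⇒∣1 {g} norm[g]≡1) p∣xy)
  ... | no norm[g]≢1  = inj₁ (subst (_∣ x) kg≡p (unit*-∣ {k} (norm≡1⇒∣1 {k} norm[k]≡1) g∣x))
    where
    open ℕ.≤-Reasoning
    kg≢0 : k * g ≢ 0#
    kg≢0 eq = p≢0 (trans (sym kg≡p) eq)
    norm[k]≡1 : norm k ≡ 1
    norm[k]≡1 = norm≤1⇒≡1 {k} (*≢0⇒ˡ≢0 {k} {g} kg≢0)
      (ℕ.*-cancelʳ-≤ (norm k) 1 (norm g) {{norm-nonZero {g} (*≢0⇒ʳ≢0 {k} {g} kg≢0)}} (begin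
        norm k ℕ.* norm g ≡⟨ norm-* k g ⟨
        norm (k * g)      ≡⟨ cong norm kg≡p ⟩
        norm p            ≤⟨ minimal g (k , kg≡p) norm[g]≢1 ⟩
        norm g            ≡⟨ ℕ.*-identityˡ (norm g) ⟨
        1 ℕ.* norm g      ∎))

-- Divisors of x have bounded norm, so a finite search decides the alternative.
smaller-nonunit-divisor? : ∀ {x} → x ≢ 0# →
  (∃[ w ] w ∣ x × norm w ≢ 1 × norm w ℕ.< norm x) ⊎ (∀ w → w ∣ x → norm w ≢ 1 → norm x ℕ.≤ norm w)
smaller-nonunit-divisor? {x} x≢0
  with Any.any? (λ w → (w ∣? x) ×-dec (¬? (norm w ℕ.≟ 1)) ×-dec (norm w ℕ.<? norm x)) (box (norm x))
... | yes smaller = let w , _ , w-smaller = find smaller in inj₁ (w , w-smaller)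
... | no ¬smaller = inj₂ λ w w∣x w≢1 → ℕ.≮⇒≥ λ w<x →
        ¬smaller (lose (∈-box w (∣⇒norm≤ x≢0 w∣x)) (w∣x , w≢1 , w<x))

∃-prime-divisor : ∀ {x} → x ≢ 0# → ¬ x ∣ 1# → ∃[ p ] Prime p × p ∣ x
∃-prime-divisor {x} = go x (<-wellFounded (norm x))
  where
  go : ∀ x → Acc ℕ._<_ (norm x) → x ≢ 0# → ¬ x ∣ 1# → ∃[ p ] Prime p × p ∣ x
  go x (acc rec) x≢0 x∤1 with smaller-nonunit-divisor? x≢0
  ... | inj₂ minimal = x , minimal-nonunit⇒prime x≢0 x∤1 minimal , ∣-refl
  ... | inj₁ (w , w∣x@(k , kw≡x) , norm[w]≢1 , w<x) =
    let p , p-prime , p∣w = go w (rec w<x) (*≢0⇒ʳ≢0 {k} {w} (λ eq → x≢0 (trans (sym kw≡x) eq)))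
                              (λ w∣1 → norm[w]≢1 (∣1⇒norm≡1 {w} w∣1))
    in p , p-prime , ∣-trans p∣w w∣x

-- Unitary divisors

i*[a+ib] : ∀ a b → ((+ 0) +i (+ 1)) * (a +i b) ≡ (ℤ.- b) +i a
i*[a+ib] a b = cong₂ _+i_ (p a b) (q a b)
  where
  p : ∀ a b → + 0 ℤ.* a ℤ.- + 1 ℤ.* b ≡ ℤ.- b
  p = ℤ.solve-∀
  q : ∀ a b → + 0 ℤ.* b ℤ.+ + 1 ℤ.* a ≡ a
  q = ℤ.solve-∀

-i*[a+ib] : ∀ a b → ((+ 0) +i -[1+ 0 ]) * (a +i b) ≡ b +i (ℤ.- a)
-i*[a+ib] a b = cong₂ _+i_ (p a b) (q a b)
  where
  p : ∀ a b → + 0 ℤ.* a ℤ.- -[1+ 0 ] ℤ.* b ≡ b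
  p = ℤ.solve-∀
  q : ∀ a b → + 0 ℤ.* b ℤ.+ -[1+ 0 ] ℤ.* a ≡ ℤ.- a
  q = ℤ.solve-∀

-1*[a+ib] : ∀ a b → (-[1+ 0 ] +i (+ 0)) * (a +i b) ≡ (ℤ.- a) +i (ℤ.- b)
-1*[a+ib] a b = cong₂ _+i_ (p a b) (q a b)
  where
  p : ∀ a b → -[1+ 0 ] ℤ.* a ℤ.- + 0 ℤ.* b ≡ ℤ.- a
  p = ℤ.solve-∀
  q : ∀ a b → -[1+ 0 ] ℤ.* b ℤ.+ + 0 ℤ.* a ≡ ℤ.- b
  q = ℤ.solve-∀

-- The unit that turns z into `A`. Each half-axis goes with the quadrant that follows it
-- counterclockwise, matching the half-open `A`; the value at 0 is a default.
rotation : ℤ[i] → ℤ[i]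
rotation ((+ suc _)  +i (+ _))     = (+ 1) +i (+ 0)
rotation ((+ zero)   +i (+ _))     = (+ 0) +i -[1+ 0 ]
rotation (-[1+ _ ]   +i (+ suc _)) = (+ 0) +i -[1+ 0 ]
rotation (-[1+ _ ]   +i (+ zero))  = -[1+ 0 ] +i (+ 0)
rotation (-[1+ _ ]   +i -[1+ _ ])  = -[1+ 0 ] +i (+ 0)
rotation ((+ _)      +i -[1+ _ ])  = (+ 0) +i (+ 1)

norm-rotation : ∀ z → norm (rotation z) ≡ 1
norm-rotation ((+ suc _)  +i (+ _))     = refl
norm-rotation ((+ zero)   +i (+ _))     = refl
norm-rotation (-[1+ _ ]   +i (+ suc _)) = refl
norm-rotation (-[1+ _ ]   +i (+ zero))  = refl
norm-rotation (-[1+ _ ]   +i -[1+ _ ])  = refl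
norm-rotation ((+ zero)   +i -[1+ _ ])  = refl
norm-rotation ((+ suc _)  +i -[1+ _ ])  = refl

-- the associate of z in the quadrant A, for z ≢ 0#
canonical : ℤ[i] → ℤ[i]
canonical z = rotation z * z

A-positive : ∀ {m n} → A ((+ suc m) +i (+ n))
A-positive = ℤ.+<+ (s≤s z≤n) , ℤ.+≤+ z≤n

A-canonical : ∀ {z} → z ≢ 0# → A (canonical z)
A-canonical {(+ suc m)  +i (+ n)}     _   = subst A (sym (*-identityˡ ((+ suc m) +i (+ n)))) A-positive
A-canonical {(+ zero)   +i (+ zero)}  z≢0 = contradiction refl z≢0
A-canonical {(+ zero)   +i (+ suc n)} _   = subst A (sym (-i*[a+ib] (+ 0) (+ suc n))) A-positive
A-canonical { -[1+ m ]  +i (+ suc n)} _   = subst A (sym (-i*[a+ib] -[1+ m ] (+ suc n))) A-positive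
A-canonical { -[1+ m ]  +i (+ zero)}  _   = subst A (sym (-1*[a+ib] -[1+ m ] (+ 0))) A-positive
A-canonical { -[1+ m ]  +i -[1+ n ]}  _   = subst A (sym (-1*[a+ib] -[1+ m ] -[1+ n ])) A-positive
A-canonical {(+ zero)   +i -[1+ n ]}  _   = subst A (sym (i*[a+ib] (+ 0) -[1+ n ])) A-positive
A-canonical {(+ suc m)  +i -[1+ n ]}  _   = subst A (sym (i*[a+ib] (+ suc m) -[1+ n ])) A-positive

0<-i⇒0≰i : ∀ {i} → + 0 ℤ.< ℤ.- i → ¬ + 0 ℤ.≤ i
0<-i⇒0≰i 0<-i = ℤ.<⇒≱ (ℤ.neg-cancel-< 0<-i)

-- For c + di in `A`, multiplication by i gives real part -d ≤ 0, by -i imaginary part -c < 0, by -1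
-- real part -c < 0. All other u except 1 are refuted by computing their norm. Hence `A` meets each
-- class of nonzero associates at most once.
unit-fixing-A≡1 : ∀ u x → norm u ≡ 1 → A x → A (u * x) → u ≡ 1#
unit-fixing-A≡1 ((+ 0) +i (+ 1)) (c +i d) _ (_ , 0≤d) Aux =
  contradiction 0≤d (0<-i⇒0≰i (proj₁ (subst A (i*[a+ib] c d) Aux)))
unit-fixing-A≡1 ((+ 0) +i -[1+ 0 ]) (c +i d) _ (0<c , _) Aux =
  contradiction (proj₂ (subst A (-i*[a+ib] c d) Aux)) (0<-i⇒0≰i (subst (+ 0 ℤ.<_) (sym (ℤ.neg-involutive c)) 0<c))
unit-fixing-A≡1 ((+ 0) +i (+ 0)) _ ()
unit-fixing-A≡1 ((+ 0) +i (+ suc (suc _))) _ ()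
unit-fixing-A≡1 ((+ 0) +i -[1+ suc _ ]) _ ()
unit-fixing-A≡1 ((+ 1) +i (+ 0)) _ _ _ _ = refl
unit-fixing-A≡1 ((+ 1) +i (+ suc _)) _ ()
unit-fixing-A≡1 ((+ 1) +i -[1+ _ ]) _ ()
unit-fixing-A≡1 (-[1+ 0 ] +i (+ 0)) (c +i d) _ (0<c , _) Aux =
  contradiction (ℤ.<⇒≤ 0<c) (0<-i⇒0≰i (proj₁ (subst A (-1*[a+ib] c d) Aux)))
unit-fixing-A≡1 (-[1+ 0 ] +i (+ suc _)) _ ()
unit-fixing-A≡1 (-[1+ 0 ] +i -[1+ _ ]) _ ()
unit-fixing-A≡1 ((+ suc (suc _)) +i _) _ ()
unit-fixing-A≡1 (-[1+ suc _ ] +i _) _ ()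

A-associates-≡ : ∀ {x y} u → norm u ≡ 1 → A x → A y → y ≡ u * x → y ≡ x
A-associates-≡ {x} u norm[u]≡1 Ax Ay refl =
  trans (cong (_* x) (unit-fixing-A≡1 u x norm[u]≡1 Ax Ay)) (*-identityˡ x)

interchange : ∀ a b c d → (a * b) * (c * d) ≡ (a * c) * (b * d)
interchange a b c d = begin
  (a * b) * (c * d) ≡⟨ *-assoc a b (c * d) ⟩
  a * (b * (c * d)) ≡⟨ cong (a *_) (x∙yz≡y∙xz b c d) ⟩
  a * (c * (b * d)) ≡⟨ *-assoc a c (b * d) ⟨
  (a * c) * (b * d) ∎
  where open ≡-Reasoning

unit-interchange : ∀ {u v} q x → v * u ≡ 1# → (v * q) * (u * x) ≡ q * x
unit-interchange {u} {v} q x vu≡1 =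
  trans (interchange v q u x) (trans (cong (_* (q * x)) vu≡1) (*-identityˡ (q * x)))

-- In m w = p q the prime p must divide m, since it does not divide w; then p cancels from both
-- sides.
prime-cancel : ∀ {p w q} → Prime p → ¬ p ∣ w → w ∣ p * q → w ∣ q
prime-cancel {p} {w} {q} p-prime p∤w (m , mw≡pq) = go (Prime.split-∣ p-prime {m} {w} (q , trans (*-comm q p) (sym mw≡pq)))
  where
  open ≡-Reasoning
  go : p ∣ m ⊎ p ∣ w → w ∣ q
  go (inj₂ p∣w)       = contradiction p∣w p∤w
  go (inj₁ (n , np≡m)) = n , *-cancelʳ p (Prime.p≉0 p-prime) (begin
    n * w * p         ≡⟨ *-comm (n * w) p ⟩
    p * (n * w)       ≡⟨ *-assoc p n w ⟨
    p * n * w         ≡⟨ cong (_* w) (*-comm p n) ⟩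
    n * p * w         ≡⟨ cong (_* w) np≡m ⟩
    m * w             ≡⟨ mw≡pq ⟩
    p * q             ≡⟨ *-comm p q ⟩
    q * p             ∎)

-- Supplies the hypothesis `cancel` under which a prime power is stripped from an element below.
prime-power-cancel : ∀ {p} → Prime p → ∀ k {w q} → ¬ p ∣ w → w ∣ p ^ k * q → w ∣ q
prime-power-cancel p-prime zero {w} {q} _ w∣1q = subst (w ∣_) (*-identityˡ q) w∣1q
prime-power-cancel {p} p-prime (suc k) {w} {q} p∤w w∣ppᵏq =
  prime-power-cancel p-prime k p∤w (prime-cancel p-prime p∤w (subst (w ∣_) (*-assoc p (p ^ k) q) w∣ppᵏq))

-- Injectivity is asked on P alone because d ↦ `canonical (P * d)` is injective on `A` but
-- identifies associates elsewhere.
map-unique : ∀ {a b p} {X : Set a} {Y : Set b} {P : X → Set p} {f : X → Y} →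
  (∀ {x y} → P x → P y → f x ≡ f y → x ≡ y) →
  ∀ {xs} → All P xs → Unique xs → Unique (map f xs)
map-unique inj []         []         = []
map-unique inj (px ∷ pxs) (x∉ ∷ xs!) =
  All.map⁺ (All.zipWith (λ (py , x≢y) fx≡fy → x≢y (inj px py fx≡fy)) (pxs , x∉)) ∷ map-unique inj pxs xs!

-- P stands for a positive power of the prime p.
module _ {p P y : ℤ[i]} (p∤1 : ¬ p ∣ 1#) (p∣P : p ∣ P) (P≢0 : P ≢ 0#) (y≢0 : y ≢ 0#) (p∤y : ¬ p ∣ y)
  (cancel : ∀ {w q} → ¬ p ∣ w → w ∣ P * q → w ∣ q)
  where

  -- A common divisor of d and P q divides y, hence is not divisible by p, so P cancels and it
  -- divides q.
  ◇-extend : ∀ {d} → d ◇ y → d ◇ P * y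
  ◇-extend {d} (Ad , (q , qd≡y) , coprime) =
    Ad , (P * q , trans (*-assoc P q d) (cong (P *_) qd≡y)) , λ w∣d w∣Pq →
      coprime w∣d (cancel (λ p∣w → p∤y (∣-trans p∣w (∣-trans w∣d (q , qd≡y)))) w∣Pq)

  -- The cofactor of u P d is v q with v inverse to u. A common divisor of the two divides q, hence
  -- y, so p does not divide it; cancelling P makes it a common divisor of d and q.
  ◇-scale : ∀ {d} → d ◇ y → canonical (P * d) ◇ P * y
  ◇-scale {d} (Ad , (q , qd≡y) , coprime) =
    A-canonical (*≢0 P≢0 (A⇒≢0 Ad)) ,
    (v * q , trans (unit-interchange {u} {v} q (P * d) vu≡1) (trans (x∙yz≡y∙xz q P d) (cong (P *_) qd≡y))) ,
    λ {w} w∣uPd w∣vq →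
      let w∣q = ∣-trans w∣vq (unit*-∣ {v} {q} (u , trans (*-comm u v) vu≡1) ∣-refl)
          w∣Pd = ∣-trans w∣uPd (unit*-∣ {u} {P * d} (v , vu≡1) ∣-refl)
          p∤w = λ p∣w → p∤y (∣-trans p∣w (∣-trans w∣q (subst (q ∣_) qd≡y (m∣m*n q d))))
      in coprime (cancel p∤w w∣Pd) w∣q
    where
    u = rotation (P * d)
    v = conj u
    vu≡1 : v * u ≡ 1#
    vu≡1 = conj-inverse {u} (norm-rotation (P * d))

  -- Cancelling P shows x ∣ y. The cofactor of x in P y is then P times its cofactor in y, so
  -- coprimality passes down.
  ◇-restrict : ∀ {x} → x ◇ P * y → ¬ p ∣ x → x ◇ y
  ◇-restrict {x} (Ax , x∣Py@(q , qx≡Py) , coprime) p∤x = Ax , x∣y , λ {w} w∣x w∣r →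
    coprime w∣x (subst (w ∣_) (sym q≡Pr) (∣n⇒∣m*n P w∣r))
    where
    x∣y = cancel p∤x x∣Py
    r = ∣.quotient x∣y
    rx≡y = ∣.equality x∣y
    q≡Pr : q ≡ P * r
    q≡Pr = *-cancelʳ x (A⇒≢0 Ax) (trans qx≡Py (trans (cong (P *_) (sym rx≡y)) (sym (*-assoc P r x))))

  -- As p divides x, it does not divide the coprime cofactor q. So q divides y, say y = s q, and x =
  -- P s absorbs all of P. Take d to be the associate of s in `A`; then x and `canonical (P * d)`
  -- are associates that both lie in `A`, hence equal.
  ◇-unscale : ∀ {x} → x ◇ P * y → p ∣ x → ∃[ d ] d ◇ y × x ≡ canonical (P * d)
  ◇-unscale {x} (Ax , (q , qx≡Py) , coprime) p∣x =
    u * s , (Ad , (v * q , d-quotient) , d-coprime) , x≡canonical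
    where
    q∣y : q ∣ y
    q∣y = cancel (λ p∣q → p∤1 (coprime p∣x p∣q)) (x , trans (*-comm x q) qx≡Py)
    s = ∣.quotient q∣y
    sq≡y = ∣.equality q∣y
    u = rotation s
    v = conj u
    vu≡1 : v * u ≡ 1#
    vu≡1 = conj-inverse {u} (norm-rotation s)
    q≢0 : q ≢ 0#
    q≢0 q≡0 = y≢0 (trans (sym sq≡y) (trans (cong (s *_) q≡0) (*-zeroʳ s)))
    x≡Ps : x ≡ P * s
    x≡Ps = *-cancelʳ q q≢0 (trans (*-comm x q) (trans qx≡Py (trans (cong (P *_) (sym sq≡y)) (sym (*-assoc P s q)))))
    s≢0 : s ≢ 0#
    s≢0 s≡0 = A⇒≢0 Ax (trans x≡Ps (trans (cong (P *_) s≡0) (*-zeroʳ P)))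
    Ad : A (u * s)
    Ad = A-canonical s≢0
    d-quotient : (v * q) * (u * s) ≡ y
    d-quotient = trans (unit-interchange {u} {v} q s vu≡1) (trans (*-comm q s) sq≡y)
    d-coprime : Coprime (u * s) (v * q)
    d-coprime {w} w∣us w∣vq = coprime
      (subst (w ∣_) (sym x≡Ps) (∣n⇒∣m*n P (∣-trans w∣us (unit*-∣ {u} {s} (v , vu≡1) ∣-refl))))
      (∣-trans w∣vq (unit*-∣ {v} {q} (u , trans (*-comm u v) vu≡1) ∣-refl))
    u′ = rotation (P * (u * s))
    norm[u′u]≡1 : norm (u′ * u) ≡ 1
    norm[u′u]≡1 = trans (norm-* u′ u) (cong₂ ℕ._*_ (norm-rotation (P * (u * s))) (norm-rotation s))
    x≡canonical : x ≡ canonical (P * (u * s))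
    x≡canonical = sym (A-associates-≡ (u′ * u) norm[u′u]≡1 Ax (A-canonical (*≢0 P≢0 (A⇒≢0 Ad))) (begin
      u′ * (P * (u * s)) ≡⟨ cong (u′ *_) (x∙yz≡y∙xz P u s) ⟩
      u′ * (u * (P * s)) ≡⟨ *-assoc u′ u (P * s) ⟨
      u′ * u * (P * s)   ≡⟨ cong (u′ * u *_) x≡Ps ⟨
      u′ * u * x         ∎))
      where open ≡-Reasoning

  canonical-scale-injective : ∀ {d e} → A d → A e → canonical (P * d) ≡ canonical (P * e) → d ≡ e
  canonical-scale-injective {d} {e} Ad Ae eq = A-associates-≡ (conj v * u) norm≡1 Ae Ad (begin
    d                ≡⟨ *-identityˡ d ⟨
    1# * d           ≡⟨ cong (_* d) (conj-inverse {v} (norm-rotation (P * d))) ⟨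
    conj v * v * d   ≡⟨ *-assoc (conj v) v d ⟩
    conj v * (v * d) ≡⟨ cong (conj v *_) vd≡ue ⟩
    conj v * (u * e) ≡⟨ *-assoc (conj v) u e ⟨
    conj v * u * e   ∎)
    where
    open ≡-Reasoning
    v = rotation (P * d)
    u = rotation (P * e)
    norm≡1 : norm (conj v * u) ≡ 1
    norm≡1 = trans (norm-* (conj v) u)
      (cong₂ ℕ._*_ (trans (norm-conj v) (norm-rotation (P * d))) (norm-rotation (P * e)))
    vd≡ue : v * d ≡ u * e
    vd≡ue = *-cancelʳ P P≢0 (trans (*-comm (v * d) P) (trans (x∙yz≡y∙xz P v d)
      (trans eq (trans (x∙yz≡y∙xz u P e) (*-comm P (u * e))))))

  -- Duplicate-free lists with the same members are permutations of each other. The two halves on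
  -- the right are disjoint because p divides every member of the second and none of the first.
  unitaryDivisors-↭ : unitaryDivisors (P * y) ↭
    unitaryDivisors y ++ map (λ d → canonical (P * d)) (unitaryDivisors y)
  unitaryDivisors-↭ = ∼bag⇒↭ (unique∧set⇒bag (unitaryDivisors-unique (P * y))
    (Unique.++⁺ (unitaryDivisors-unique y)
      (map-unique canonical-scale-injective (All.tabulate (λ d∈ → proj₁ (fromList d∈))) (unitaryDivisors-unique y))
      disjoint)
    (mk⇔ to from))
    where
    scale : ℤ[i] → ℤ[i]
    scale d = canonical (P * d)
    fromList : ∀ {d} → d ∈ unitaryDivisors y → d ◇ y
    fromList = Equivalence.to (∈-unitaryDivisors y≢0)
    toList : ∀ {d} → d ◇ y → d ∈ unitaryDivisors y
    toList = Equivalence.from (∈-unitaryDivisors y≢0)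
    Py≢0 : P * y ≢ 0#
    Py≢0 = *≢0 P≢0 y≢0
    disjoint : ∀ {x} → ¬ (x ∈ unitaryDivisors y × x ∈ map scale (unitaryDivisors y))
    disjoint (x∈ , x∈′) =
      let d , _ , x≡scale[d] = ∈.∈-map⁻ scale x∈′
      in p∤y (∣-trans (subst (p ∣_) (sym x≡scale[d]) (∣n⇒∣m*n (rotation (P * d)) (∣-trans p∣P (m∣m*n P d))))
                      (proj₁ (proj₂ (fromList x∈))))
    to : ∀ {x} → x ∈ unitaryDivisors (P * y) → x ∈ unitaryDivisors y ++ map scale (unitaryDivisors y)
    to {x} x∈ with p ∣? x
    ... | no p∤x  = ∈.∈-++⁺ˡ (toList (◇-restrict (Equivalence.to (∈-unitaryDivisors Py≢0) x∈) p∤x))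
    ... | yes p∣x =
      let d , d◇y , x≡scale[d] = ◇-unscale (Equivalence.to (∈-unitaryDivisors Py≢0) x∈) p∣x
      in ∈.∈-++⁺ʳ (unitaryDivisors y)
           (subst (_∈ map scale (unitaryDivisors y)) (sym x≡scale[d]) (∈.∈-map⁺ scale (toList d◇y)))
    from : ∀ {x} → x ∈ unitaryDivisors y ++ map scale (unitaryDivisors y) → x ∈ unitaryDivisors (P * y)
    from x∈ with ∈.∈-++⁻ (unitaryDivisors y) x∈
    ... | inj₁ x∈ˡ = Equivalence.from (∈-unitaryDivisors Py≢0) (◇-extend (fromList x∈ˡ))
    ... | inj₂ x∈ʳ =
      let d , d∈ , x≡scale[d] = ∈.∈-map⁻ scale x∈ʳ
      in Equivalence.from (∈-unitaryDivisors Py≢0)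
           (subst (_◇ P * y) (sym x≡scale[d]) (◇-scale (fromList d∈)))

  δ₂*-strip : δ₂* (P * y) ≡ (1 ℕ.+ norm P) ℕ.* δ₂* y
  δ₂*-strip = begin
    sum (map norm (unitaryDivisors (P * y)))   ≡⟨ sum-↭ (↭.map⁺ norm unitaryDivisors-↭) ⟩
    sum (map norm (ds ++ map scale ds))        ≡⟨ cong sum (map-++ norm ds (map scale ds)) ⟩
    sum (map norm ds ++ map norm (map scale ds)) ≡⟨ sum-++ (map norm ds) (map norm (map scale ds)) ⟩
    δ₂* y ℕ.+ sum (map norm (map scale ds))    ≡⟨ cong (δ₂* y ℕ.+_) (sum-scale ds) ⟩
    δ₂* y ℕ.+ norm P ℕ.* δ₂* y                 ∎
    where
    open ≡-Reasoning
    ds = unitaryDivisors y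
    scale : ℤ[i] → ℤ[i]
    scale d = canonical (P * d)
    norm-scale : ∀ d → norm (scale d) ≡ norm P ℕ.* norm d
    norm-scale d = begin
      norm (rotation (P * d) * (P * d))           ≡⟨ norm-* (rotation (P * d)) (P * d) ⟩
      norm (rotation (P * d)) ℕ.* norm (P * d)    ≡⟨ cong (ℕ._* norm (P * d)) (norm-rotation (P * d)) ⟩
      1 ℕ.* norm (P * d)                          ≡⟨ ℕ.*-identityˡ (norm (P * d)) ⟩
      norm (P * d)                                ≡⟨ norm-* P d ⟩
      norm P ℕ.* norm d                           ∎
    sum-scale : ∀ xs → sum (map norm (map scale xs)) ≡ norm P ℕ.* sum (map norm xs)
    sum-scale []       = sym (ℕ.*-zeroʳ (norm P))
    sum-scale (x ∷ xs) = trans (cong₂ ℕ._+_ (norm-scale x) (sum-scale xs))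
      (sym (ℕ.*-distribˡ-+ (norm P) (norm x) (sum (map norm xs))))

-- Powers of 2

^-≢0 : ∀ {p} → p ≢ 0# → ∀ k → p ^ k ≢ 0#
^-≢0 p≢0 zero    ()
^-≢0 {p} p≢0 (suc k) = *≢0 {p} {p ^ k} p≢0 (^-≢0 p≢0 k)

δ₂*-prime-power : ∀ {p y} → Prime p → y ≢ 0# → ¬ p ∣ y → ∀ j →
  δ₂* (p ^ suc j * y) ≡ (1 ℕ.+ norm (p ^ suc j)) ℕ.* δ₂* y
δ₂*-prime-power {p} {y} p-prime y≢0 p∤y j =
  δ₂*-strip {p} {p ^ suc j} {y} (Prime.p∤1 p-prime) (m∣m*n p (p ^ j)) (^-≢0 {p} (Prime.p≉0 p-prime) (suc j)) y≢0 p∤y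
    (λ {w} {q} → prime-power-cancel p-prime (suc j) {w} {q})

-- Divisors of a unit are units, and 1 is the only unit in `A`.
δ₂*-unit : ∀ {u} → norm u ≡ 1 → δ₂* u ≡ 1
δ₂*-unit {u} norm[u]≡1 = sum-↭ (↭.map⁺ norm divisors↭)
  where
  u≢0 : u ≢ 0#
  u≢0 refl = contradiction norm[u]≡1 λ ()
  to : ∀ {x} → x ∈ unitaryDivisors u → x ∈ 1# ∷ []
  to {x} x∈ =
    let Ax , x∣u , _ = Equivalence.to (∈-unitaryDivisors u≢0) x∈
        norm[x]≡1 = ∣1⇒norm≡1 {x} (∣-trans x∣u (norm≡1⇒∣1 {u} norm[u]≡1))
    in here (unit-fixing-A≡1 x 1# norm[x]≡1 A-positive
               (subst A (trans (sym (*-identityˡ x)) (*-comm 1# x)) Ax))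
  from : ∀ {x} → x ∈ 1# ∷ [] → x ∈ unitaryDivisors u
  from (here refl) = Equivalence.from (∈-unitaryDivisors u≢0)
    (A-positive , (u , trans (*-comm u 1#) (*-identityˡ u)) , λ z∣1 _ → z∣1)
  divisors↭ : unitaryDivisors u ↭ 1# ∷ []
  divisors↭ = ∼bag⇒↭ (unique∧set⇒bag (unitaryDivisors-unique u) ([] ∷ []) (mk⇔ to from))

2≤norm : ∀ {z} → z ≢ 0# → ¬ z ∣ 1# → 2 ℕ.≤ norm z
2≤norm {z} z≢0 z∤1 = ℕ.≤∧≢⇒< (ℕ.>-nonZero⁻¹ (norm z) {{norm-nonZero {z} z≢0}})
  (λ 1≡norm → z∤1 (norm≡1⇒∣1 {z} (sym 1≡norm)))

norm-cofactor< : ∀ {p q z} → z ≢ 0# → 2 ℕ.≤ norm p → p * q ≡ z → norm q ℕ.< norm z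
norm-cofactor< {p} {q} pq≢0 2≤p refl = begin-strict
  norm q              <⟨ ℕ.m<m*n (norm q) (norm p) {{norm-nonZero {q} (*≢0⇒ʳ≢0 {p} {q} pq≢0)}} 2≤p ⟩
  norm q ℕ.* norm p   ≡⟨ ℕ.*-comm (norm q) (norm p) ⟩
  norm p ℕ.* norm q   ≡⟨ norm-* p q ⟨
  norm (p * q)        ∎
  where open ℕ.≤-Reasoning

PowerSplit : ℤ[i] → ℤ[i] → Set
PowerSplit p z = ∃[ k ] ∃[ y ] z ≡ p ^ k * y × ¬ p ∣ y

-- Each division by p strictly lowers the norm, so the process stops.
power-split : ∀ {p} → 2 ℕ.≤ norm p → ∀ {z} → z ≢ 0# → PowerSplit p z
power-split {p} 2≤p {z} z≢0 = go z z≢0 (<-wellFounded (norm z))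
  where
  cons : ∀ {q z} → p * q ≡ z → PowerSplit p q → PowerSplit p z
  cons pq≡z (k , y , q≡ , p∤y) =
    suc k , y , trans (sym pq≡z) (trans (cong (p *_) q≡) (sym (*-assoc p (p ^ k) y))) , p∤y
  go : ∀ z → z ≢ 0# → Acc ℕ._<_ (norm z) → PowerSplit p z
  go z z≢0 (acc rec) with p ∣? z
  ... | no p∤z         = 0 , z , sym (*-identityˡ z) , p∤z
  ... | yes (q , qp≡z) =
    let pq≡z = trans (*-comm p q) qp≡z
    in cons pq≡z (go q (*≢0⇒ʳ≢0 {p} {q} (λ eq → z≢0 (trans (sym pq≡z) eq)))
                   (rec (norm-cofactor< {p} {q} z≢0 2≤p pq≡z)))

2∤-* : ∀ {m n} → 2 ∤ m → 2 ∤ n → 2 ∤ m ℕ.* n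
2∤-* {m} {n} 2∤m 2∤n 2∣mn = [ 2∤m , 2∤n ]′ (euclidsLemma m n prime[2] 2∣mn)

2∤1+2n : ∀ n → 2 ∤ 1 ℕ.+ 2 ℕ.* n
2∤1+2n n 2∣ = contradiction (ℕ.∣1⇒≡1 (ℕ.∣m+n∣m⇒∣n (subst (2 ℕ.∣_) (ℕ.+-comm 1 (2 ℕ.* n)) 2∣) (ℕ.m∣m*n n))) λ ()

2^-injective : ∀ a b {m n} → 2 ∤ m → 2 ∤ n → 2 ℕ.^ a ℕ.* m ≡ 2 ℕ.^ b ℕ.* n → a ≡ b
2^-injective zero    zero    _ _ _ = refl
2^-injective zero    (suc b) {m} {n} 2∤m _ eq = contradiction
  (subst (2 ℕ.∣_) (trans (sym eq) (ℕ.*-identityˡ m)) (ℕ.∣m⇒∣m*n n (ℕ.m∣m*n (2 ℕ.^ b)))) 2∤m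
2^-injective (suc a) zero    {m} {n} _ 2∤n eq = contradiction
  (subst (2 ℕ.∣_) (trans eq (ℕ.*-identityˡ n)) (ℕ.∣m⇒∣m*n m (ℕ.m∣m*n (2 ℕ.^ a)))) 2∤n
2^-injective (suc a) (suc b) {m} {n} 2∤m 2∤n eq = cong suc (2^-injective a b 2∤m 2∤n
  (ℕ.*-cancelˡ-≡ _ _ 2 (trans (sym (ℕ.*-assoc 2 (2 ℕ.^ a) m)) (trans eq (ℕ.*-assoc 2 (2 ℕ.^ b) n)))))

n<2^n : ∀ n → n ℕ.< 2 ℕ.^ n
n<2^n zero    = s≤s z≤n
n<2^n (suc n) = begin-strict
  1 ℕ.+ n                   <⟨ ℕ.+-mono-≤-< (ℕ.m^n>0 2 n) (n<2^n n) ⟩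
  2 ℕ.^ n ℕ.+ 2 ℕ.^ n       ≡⟨ cong (2 ℕ.^ n ℕ.+_) (ℕ.+-identityʳ (2 ℕ.^ n)) ⟨
  2 ℕ.^ suc n               ∎
  where open ℕ.≤-Reasoning

-- The hypothesis says that the search starts high enough, which makes the exponent found maximal
-- among all exponents and not only among those up to b.
υ₂-upTo-spec : ∀ b t → ¬ 2 ℕ.^ suc b ℕ.∣ t → 2 ℕ.^ υ₂-upTo b t ℕ.∣ t × ¬ 2 ℕ.^ suc (υ₂-upTo b t) ℕ.∣ t
υ₂-upTo-spec zero    t ∤t = ℕ.1∣ t , ∤t
υ₂-upTo-spec (suc b) t ∤t with 2 ℕ.^ suc b ℕ.∣? t
... | yes ∣t = ∣t , ∤t
... | no ∤t′ = υ₂-upTo-spec b t ∤t′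

υ₂-spec : ∀ t .{{_ : ℕ.NonZero t}} → ∃[ s ] t ≡ 2 ℕ.^ υ₂ t ℕ.* s × 2 ∤ s
-- Starting at t is high enough, since t < 2 ^ (t + 1).
υ₂-spec t with υ₂-upTo-spec t t (λ ∣t → ℕ.<⇒≱ (ℕ.<-trans (ℕ.n<1+n t) (n<2^n (suc t))) (ℕ.∣⇒≤ ∣t))
... | ℕ.divides s t≡s*2^ , ∤t = s , trans t≡s*2^ (ℕ.*-comm s (2 ℕ.^ υ₂ t)) , λ 2∣s →
  ∤t (subst (2 ℕ.^ suc (υ₂ t) ℕ.∣_) (sym t≡s*2^) (ℕ.*-monoˡ-∣ (2 ℕ.^ υ₂ t) 2∣s))

-- Norms modulo 4 and the prime `1+i`

data Parity : ℤ → Set where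
  even : ∀ j → Parity (+ 2 ℤ.* j)
  odd  : ∀ j → Parity (+ 1 ℤ.+ + 2 ℤ.* j)

parity-suc : ∀ {a} → Parity a → Parity (+ 1 ℤ.+ a)
parity-suc (even j) = odd j
parity-suc (odd j)  = subst Parity (p j) (even (+ 1 ℤ.+ j))
  where
  p : ∀ j → + 2 ℤ.* (+ 1 ℤ.+ j) ≡ + 1 ℤ.+ (+ 1 ℤ.+ + 2 ℤ.* j)
  p = ℤ.solve-∀

parity-neg : ∀ {a} → Parity a → Parity (ℤ.- a)
parity-neg (even j) = subst Parity (p j) (even (ℤ.- j))
  where
  p : ∀ j → + 2 ℤ.* (ℤ.- j) ≡ ℤ.- (+ 2 ℤ.* j)
  p = ℤ.solve-∀
parity-neg (odd j) = subst Parity (p j) (odd (ℤ.- j ℤ.- + 1))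
  where
  p : ∀ j → + 1 ℤ.+ + 2 ℤ.* (ℤ.- j ℤ.- + 1) ≡ ℤ.- (+ 1 ℤ.+ + 2 ℤ.* j)
  p = ℤ.solve-∀

parity-ℕ : ∀ n → Parity (+ n)
parity-ℕ zero    = even (+ 0)
parity-ℕ (suc n) = parity-suc (parity-ℕ n)

parity : ∀ a → Parity a
parity (+ n)    = parity-ℕ n
parity -[1+ n ] = parity-neg (parity-ℕ (suc n))

∣2j∣² : ∀ j → ∃[ c ] ℤ.∣ + 2 ℤ.* j ∣ ℕ.* ℤ.∣ + 2 ℤ.* j ∣ ≡ 4 ℕ.* c
∣2j∣² j = ℤ.∣ j ∣ ℕ.* ℤ.∣ j ∣ , trans (cong (λ n → n ℕ.* n) (ℤ.abs-* (+ 2) j)) (p ℤ.∣ j ∣)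
  where
  p : ∀ n → (2 ℕ.* n) ℕ.* (2 ℕ.* n) ≡ 4 ℕ.* (n ℕ.* n)
  p = ℕ.solve-∀

∣1+2j∣ : ∀ j → ∃[ k ] ℤ.∣ + 1 ℤ.+ + 2 ℤ.* j ∣ ≡ 1 ℕ.+ 2 ℕ.* k
∣1+2j∣ (+ k)    = k , cong (λ a → ℤ.∣ + 1 ℤ.+ a ∣) (sym (ℤ.pos-* 2 k))
∣1+2j∣ -[1+ k ] = k , (begin
  ℤ.∣ + 1 ℤ.+ + 2 ℤ.* -[1+ k ] ∣     ≡⟨ cong ℤ.∣_∣ (p (+ k)) ⟩
  ℤ.∣ ℤ.- (+ 1 ℤ.+ + 2 ℤ.* + k) ∣    ≡⟨ ℤ.∣-i∣≡∣i∣ (+ 1 ℤ.+ + 2 ℤ.* + k) ⟩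
  ℤ.∣ + 1 ℤ.+ + 2 ℤ.* + k ∣          ≡⟨ cong (λ a → ℤ.∣ + 1 ℤ.+ a ∣) (ℤ.pos-* 2 k) ⟨
  1 ℕ.+ 2 ℕ.* k                      ∎)
  where
  open ≡-Reasoning
  p : ∀ k → + 1 ℤ.+ + 2 ℤ.* (ℤ.- (+ 1 ℤ.+ k)) ≡ ℤ.- (+ 1 ℤ.+ + 2 ℤ.* k)
  p = ℤ.solve-∀

∣1+2j∣² : ∀ j → ∃[ c ] ℤ.∣ + 1 ℤ.+ + 2 ℤ.* j ∣ ℕ.* ℤ.∣ + 1 ℤ.+ + 2 ℤ.* j ∣ ≡ 1 ℕ.+ 4 ℕ.* c
∣1+2j∣² j = let k , eq = ∣1+2j∣ j in k ℕ.* k ℕ.+ k , trans (cong (λ n → n ℕ.* n) eq) (p k)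
  where
  p : ∀ k → (1 ℕ.+ 2 ℕ.* k) ℕ.* (1 ℕ.+ 2 ℕ.* k) ≡ 1 ℕ.+ 4 ℕ.* (k ℕ.* k ℕ.+ k)
  p = ℕ.solve-∀

-- The quotient of a + bi by 1 + i is (a + b)/2 + ((b - a)/2) i, which is integral when a and b have
-- equal parity. Otherwise the norm is an even square plus an odd one.
1+i∣⊎norm≡1[4] : ∀ z → 1+i ∣ z ⊎ (∃[ c ] norm z ≡ 1 ℕ.+ 4 ℕ.* c)
1+i∣⊎norm≡1[4] (a +i b) = go (parity a) (parity b)
  where
  go : ∀ {a b} → Parity a → Parity b → 1+i ∣ a +i b ⊎ (∃[ c ] norm (a +i b) ≡ 1 ℕ.+ 4 ℕ.* c)
  go (even j) (even k) = inj₁ ((j ℤ.+ k) +i (k ℤ.- j) , cong₂ _+i_ (p j k) (q j k))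
    where
    p : ∀ j k → (j ℤ.+ k) ℤ.* + 1 ℤ.- (k ℤ.- j) ℤ.* + 1 ≡ + 2 ℤ.* j
    p = ℤ.solve-∀
    q : ∀ j k → (j ℤ.+ k) ℤ.* + 1 ℤ.+ (k ℤ.- j) ℤ.* + 1 ≡ + 2 ℤ.* k
    q = ℤ.solve-∀
  go (odd j) (odd k) = inj₁ ((+ 1 ℤ.+ j ℤ.+ k) +i (k ℤ.- j) , cong₂ _+i_ (p j k) (q j k))
    where
    p : ∀ j k → (+ 1 ℤ.+ j ℤ.+ k) ℤ.* + 1 ℤ.- (k ℤ.- j) ℤ.* + 1 ≡ + 1 ℤ.+ + 2 ℤ.* j
    p = ℤ.solve-∀
    q : ∀ j k → (+ 1 ℤ.+ j ℤ.+ k) ℤ.* + 1 ℤ.+ (k ℤ.- j) ℤ.* + 1 ≡ + 1 ℤ.+ + 2 ℤ.* k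
    q = ℤ.solve-∀
  go (even j) (odd k) = let c , eq = ∣2j∣² j ; d , eq′ = ∣1+2j∣² k in
    inj₂ (c ℕ.+ d , trans (cong₂ ℕ._+_ eq eq′) (p c d))
    where
    p : ∀ c d → 4 ℕ.* c ℕ.+ (1 ℕ.+ 4 ℕ.* d) ≡ 1 ℕ.+ 4 ℕ.* (c ℕ.+ d)
    p = ℕ.solve-∀
  go (odd j) (even k) = let c , eq = ∣1+2j∣² j ; d , eq′ = ∣2j∣² k in
    inj₂ (c ℕ.+ d , trans (cong₂ ℕ._+_ eq eq′) (p c d))
    where
    p : ∀ c d → (1 ℕ.+ 4 ℕ.* c) ℕ.+ 4 ℕ.* d ≡ 1 ℕ.+ 4 ℕ.* (c ℕ.+ d)
    p = ℕ.solve-∀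

1+i∣⇒2∣norm : ∀ {z} → 1+i ∣ z → 2 ℕ.∣ norm z
1+i∣⇒2∣norm (q , refl) = ℕ.divides (norm q) (norm-* q 1+i)

2∤norm⇒norm≡1[4] : ∀ {z} → 2 ∤ norm z → ∃[ c ] norm z ≡ 1 ℕ.+ 4 ℕ.* c
2∤norm⇒norm≡1[4] {z} 2∤ with 1+i∣⊎norm≡1[4] z
... | inj₁ 1+i∣z = contradiction (1+i∣⇒2∣norm {z} 1+i∣z) 2∤
... | inj₂ eq    = eq

1+i∤⇒2∤norm : ∀ {z} → ¬ 1+i ∣ z → 2 ∤ norm z
1+i∤⇒2∤norm {z} 1+i∤z with 1+i∣⊎norm≡1[4] z
... | inj₁ 1+i∣z    = contradiction 1+i∣z 1+i∤z
... | inj₂ (c , eq) = subst (2 ∤_) (sym (trans eq (cong suc (ℕ.*-assoc 2 2 c)))) (2∤1+2n (2 ℕ.* c))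

-- Not being divisible by `1+i` forces an odd norm, and odd norms have an odd product.
1+i-prime : Prime 1+i
1+i-prime = record
  { p≉0     = λ ()
  ; p∤1     = λ 1+i∣1 → contradiction (∣1⇒norm≡1 {1+i} 1+i∣1) λ ()
  ; split-∣ = λ {x} {y} → split x y
  }
  where
  split : ∀ x y → 1+i ∣ x * y → 1+i ∣ x ⊎ 1+i ∣ y
  split x y 1+i∣xy with 1+i ∣? x | 1+i ∣? y
  ... | yes 1+i∣x | _         = inj₁ 1+i∣x
  ... | no _      | yes 1+i∣y = inj₂ 1+i∣y
  ... | no 1+i∤x  | no 1+i∤y  = contradiction
    (subst (2 ℕ.∣_) (norm-* x y) (1+i∣⇒2∣norm {x * y} 1+i∣xy))
    (2∤-* (1+i∤⇒2∤norm {x} 1+i∤x) (1+i∤⇒2∤norm {y} 1+i∤y))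

-- Counting prime divisors of elements of odd norm

norm-^ : ∀ p k → norm (p ^ k) ≡ norm p ℕ.^ k
norm-^ p zero    = refl
norm-^ p (suc k) = trans (norm-* p (p ^ k)) (cong (norm p ℕ.*_) (norm-^ p k))

prime-∣^⇒∣ : ∀ {p q} → Prime q → ∀ k → q ∣ p ^ k → q ∣ p
prime-∣^⇒∣ q-prime zero q∣1 = contradiction q∣1 (Prime.p∤1 q-prime)
prime-∣^⇒∣ {p} q-prime (suc k) q∣ppᵏ with Prime.split-∣ q-prime {p} {p ^ k} q∣ppᵏ
... | inj₁ q∣p  = q∣p
... | inj₂ q∣pᵏ = prime-∣^⇒∣ {p} q-prime k q∣pᵏ

-- In p = r q the prime p divides r or q. The first would make q a unit; the second makes p and q
-- divide each other.
prime-∣⇒associated : ∀ {p q} → Prime p → Prime q → q ∣ p → Associated q p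
prime-∣⇒associated {p} {q} p-prime q-prime (r , rq≡p) =
  go (Prime.split-∣ p-prime {r} {q} (1# , trans (*-identityˡ p) (sym rq≡p)))
  where
  open ≡-Reasoning
  go : p ∣ r ⊎ p ∣ q → Associated q p
  go (inj₁ (s , sp≡r)) = contradiction (s , *-cancelʳ p (Prime.p≉0 p-prime) (begin
    s * q * p     ≡⟨ *-assoc s q p ⟩
    s * (q * p)   ≡⟨ cong (s *_) (*-comm q p) ⟩
    s * (p * q)   ≡⟨ *-assoc s p q ⟨
    s * p * q     ≡⟨ cong (_* q) sp≡r ⟩
    r * q         ≡⟨ rq≡p ⟩
    p             ≡⟨ *-identityˡ p ⟨
    1# * p        ∎)) (Prime.p∤1 q-prime)
  go (inj₂ (t , tp≡q)) = t , (r , *-cancelʳ p (Prime.p≉0 p-prime) (begin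
    r * t * p     ≡⟨ *-assoc r t p ⟩
    r * (t * p)   ≡⟨ cong (r *_) tp≡q ⟩
    r * q         ≡⟨ rq≡p ⟩
    p             ≡⟨ *-identityˡ p ⟨
    1# * p        ∎)) , sym tp≡q

-- The new p is associated to no earlier prime, since those divide y. A prime dividing the product
-- divides y, or divides p and so is associated to it.
hasExactlyPrimeDivisors-extend : ∀ {p y n} → Prime p → ¬ p ∣ y → ∀ j →
  HasExactlyPrimeDivisors n y → HasExactlyPrimeDivisors (suc n) (p ^ suc j * y)
hasExactlyPrimeDivisors-extend {p} {y} p-prime p∤y j (ps , ps-divide , ps-distinct , ps-complete) =
  p ∷ ps ,
  (p-prime , ∣-trans (m∣m*n p (p ^ j)) (m∣m*n (p ^ suc j) y)) ∷
    VecAll.map (λ (q-prime , q∣y) → q-prime , ∣n⇒∣m*n (p ^ suc j) q∣y) ps-divide ,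
  VecAll.map (λ {q} (_ , q∣y) (u , u∣1 , p≡uq) →
    p∤y (∣-trans (subst (_∣ q) (sym p≡uq) (unit*-∣ {u} {q} u∣1 ∣-refl)) q∣y)) ps-divide ∷ ps-distinct ,
  λ q q-prime q∣ → [ (λ q∣P → here (prime-∣⇒associated p-prime q-prime (prime-∣^⇒∣ {p} q-prime (suc j) q∣P)))
                   , (λ q∣y → there (ps-complete q q-prime q∣y)) ]′
                   (Prime.split-∣ q-prime {p ^ suc j} {y} q∣)

-- One n serves both as the number of prime classes and as the exponent of 2 in δ, so a single
-- induction proves that they agree.
OddCount : ℤ[i] → Set
OddCount x = ∃[ n ] ∃[ m ] HasExactlyPrimeDivisors n x × δ₂* x ≡ 2 ℕ.^ n ℕ.* m × 2 ∤ m

oddCount-extend : ∀ {p y} → Prime p → y ≢ 0# → ¬ p ∣ y → ∀ j → 2 ∤ norm (p ^ suc j) →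
  OddCount y → OddCount (p ^ suc j * y)
oddCount-extend {p} {y} p-prime y≢0 p∤y j 2∤norm[P] (n , m , exactly , δ≡ , 2∤m) =
  -- With `norm (p ^ suc j)` = 1 + 4c the stripped factor is 2 + 4c, whose odd half is 1 + 2c.
  suc n , (1 ℕ.+ 2 ℕ.* c) ℕ.* m , hasExactlyPrimeDivisors-extend p-prime p∤y j exactly ,
  trans (δ₂*-prime-power p-prime y≢0 p∤y j)
    (trans (cong₂ (λ N δ → (1 ℕ.+ N) ℕ.* δ) norm[P]≡ δ≡) (rearrange c (2 ℕ.^ n) m)) ,
  2∤-* {1 ℕ.+ 2 ℕ.* c} (2∤1+2n c) 2∤m
  where
  c = proj₁ (2∤norm⇒norm≡1[4] {p ^ suc j} 2∤norm[P])
  norm[P]≡ = proj₂ (2∤norm⇒norm≡1[4] {p ^ suc j} 2∤norm[P])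
  rearrange : ∀ c e m → (1 ℕ.+ (1 ℕ.+ 4 ℕ.* c)) ℕ.* (e ℕ.* m) ≡ 2 ℕ.* e ℕ.* ((1 ℕ.+ 2 ℕ.* c) ℕ.* m)
  rearrange = ℕ.solve-∀

oddCount-unit : ∀ {u} → norm u ≡ 1 → OddCount u
oddCount-unit {u} norm[u]≡1 = 0 , 1 ,
  ([] , [] , [] , λ q q-prime q∣u →
    contradiction (∣-trans q∣u (norm≡1⇒∣1 {u} norm[u]≡1)) (Prime.p∤1 q-prime)) ,
  δ₂*-unit {u} norm[u]≡1 , 2∤1+2n 0

2∤norm⇒≢0 : ∀ {x} → 2 ∤ norm x → x ≢ 0#
2∤norm⇒≢0 2∤ refl = 2∤ (2 ℕ.∣0)

2∤norm-factors : ∀ x y → 2 ∤ norm (x * y) → 2 ∤ norm x × 2 ∤ norm y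
2∤norm-factors x y 2∤ =
  (λ 2∣x → 2∤ (subst (2 ℕ.∣_) (sym (norm-* x y)) (ℕ.∣m⇒∣m*n (norm y) 2∣x))) ,
  (λ 2∣y → 2∤ (subst (2 ℕ.∣_) (sym (norm-* x y)) (ℕ.∣n⇒∣m*n (norm x) 2∣y)))

oddCount : ∀ {x} → 2 ∤ norm x → OddCount x
oddCount {x} 2∤ = go x 2∤ (<-wellFounded (norm x))
  where
  go : ∀ x → 2 ∤ norm x → Acc ℕ._<_ (norm x) → OddCount x
  peel : ∀ {p x} → 2 ∤ norm x → Prime p → p ∣ x → (∀ y → 2 ∤ norm y → norm y ℕ.< norm x → OddCount y) →
         PowerSplit p x → OddCount x
  -- Exponent 0 is excluded by p ∣ x, so the cofactor has smaller norm in the remaining case.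
  peel {p} {x} _  _       p∣x _   (zero , y , x≡y , p∤y) =
    contradiction (subst (p ∣_) (trans x≡y (*-identityˡ y)) p∣x) p∤y
  peel {p} {x} 2∤ p-prime p∣x rec (suc j , y , x≡Py , p∤y) =
    let 2∤P , 2∤y = 2∤norm-factors (p ^ suc j) y (subst (λ w → 2 ∤ norm w) x≡Py 2∤)
        x≢0 = 2∤norm⇒≢0 {x} 2∤
        2≤P = 2≤norm {p ^ suc j} (2∤norm⇒≢0 {p ^ suc j} 2∤P)
                (λ P∣1 → Prime.p∤1 p-prime (∣-trans (m∣m*n p (p ^ j)) P∣1))
    in subst OddCount (sym x≡Py)
         (oddCount-extend p-prime (2∤norm⇒≢0 {y} 2∤y) p∤y j 2∤P
           (rec y 2∤y (norm-cofactor< {p ^ suc j} {y} x≢0 2≤P (sym x≡Py))))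
  go x 2∤ (acc rec) with norm x ℕ.≟ 1
  ... | yes norm[x]≡1 = oddCount-unit {x} norm[x]≡1
  ... | no norm[x]≢1  =
    let x≢0 = 2∤norm⇒≢0 {x} 2∤
        p , p-prime , p∣x = ∃-prime-divisor x≢0 (λ x∣1 → norm[x]≢1 (∣1⇒norm≡1 {x} x∣1))
    in peel 2∤ p-prime p∣x (λ y 2∤y y<x → go y 2∤y (rec y<x))
         (power-split {p} (2≤norm {p} (Prime.p≉0 p-prime) (Prime.p∤1 p-prime)) x≢0)

-- The exponent 0 is set apart: nothing is stripped then and the factor is 1, whereas 1 + 2^0 would
-- be even.
δ₂*-1+i-power : ∀ γ {x} → x ≢ 0# → ¬ 1+i ∣ x → ∃[ ε ] δ₂* (1+i ^ γ * x) ≡ ε ℕ.* δ₂* x × 2 ∤ ε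
δ₂*-1+i-power zero    {x} _   _     = 1 , trans (cong δ₂* (*-identityˡ x)) (sym (ℕ.*-identityˡ (δ₂* x))) , 2∤1+2n 0
δ₂*-1+i-power (suc j) {x} x≢0 1+i∤x =
  1 ℕ.+ norm (1+i ^ suc j) , δ₂*-prime-power 1+i-prime x≢0 1+i∤x j ,
  subst (λ n → 2 ∤ 1 ℕ.+ n) (sym (norm-^ 1+i (suc j))) (2∤1+2n (2 ℕ.^ j))

I₂*≡t⇒δ₂*≡t*norm : ∀ z (z≢0 : z ≢ 0#) t → I₂* z z≢0 ≡ (+ t) / 1 → δ₂* z ≡ t ℕ.* norm z
I₂*≡t⇒δ₂*≡t*norm z z≢0 t eq = trans (sym (ℕ.*-identityʳ (δ₂* z)))
  (ℚ.normalize-injective-≃ (δ₂* z) t (norm z) 1 {{norm-nonZero {z} z≢0}} eq)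

theorem2p3 : (z : ℤ[i]) (z≢0 : z ≢ 0#) (t : ℕ) → 2 ℕ.≤ t → I₂* z z≢0 ≡ (+ t) / 1 →
    ∃[ γ ] ∃[ x ] (z ≡ 1+i ^ γ * x × 2 ∤ norm x × HasExactlyPrimeDivisors (γ ℕ.+ υ₂ t) x)
theorem2p3 z z≢0 t 2≤t I≡t =
  let γ , x , z≡ , 1+i∤x = power-split {1+i} ℕ.≤-refl z≢0
      2∤x = 1+i∤⇒2∤norm {x} 1+i∤x
      n , m , exactly , δ≡ , 2∤m = oddCount {x} 2∤x
      s , t≡ , 2∤s = υ₂-spec t {{ℕ.>-nonZero (ℕ.≤-trans (s≤s z≤n) 2≤t)}}
      ε , δ[z]≡ , 2∤ε = δ₂*-1+i-power γ {x} (2∤norm⇒≢0 {x} 2∤x) 1+i∤x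
      -- The odd parts of the two sides are ε m for δ(z) and s N(x) for t N(z), so the exponents of
      -- 2 must coincide.
      n≡ = 2^-injective n (γ ℕ.+ υ₂ t) (2∤-* 2∤ε 2∤m) (2∤-* 2∤s 2∤x) (begin
        2 ℕ.^ n ℕ.* (ε ℕ.* m)                     ≡⟨ p (2 ℕ.^ n) ε m ⟩
        ε ℕ.* (2 ℕ.^ n ℕ.* m)                     ≡⟨ cong (ε ℕ.*_) δ≡ ⟨
        ε ℕ.* δ₂* x                               ≡⟨ δ[z]≡ ⟨
        δ₂* (1+i ^ γ * x)                         ≡⟨ cong δ₂* z≡ ⟨
        δ₂* z                                     ≡⟨ I₂*≡t⇒δ₂*≡t*norm z z≢0 t I≡t ⟩
        t ℕ.* norm z                              ≡⟨ cong₂ ℕ._*_ t≡ (trans (cong norm z≡)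
                                                       (trans (norm-* (1+i ^ γ) x) (cong (ℕ._* norm x) (norm-^ 1+i γ)))) ⟩
        2 ℕ.^ υ₂ t ℕ.* s ℕ.* (2 ℕ.^ γ ℕ.* norm x) ≡⟨ q (2 ℕ.^ υ₂ t) s (2 ℕ.^ γ) (norm x) ⟩
        2 ℕ.^ γ ℕ.* 2 ℕ.^ υ₂ t ℕ.* (s ℕ.* norm x) ≡⟨ cong (ℕ._* (s ℕ.* norm x)) (ℕ.^-distribˡ-+-* 2 γ (υ₂ t)) ⟨
        2 ℕ.^ (γ ℕ.+ υ₂ t) ℕ.* (s ℕ.* norm x)     ∎)
  in γ , x , z≡ , 2∤x , subst (λ k → HasExactlyPrimeDivisors k x) n≡ exactly
  where
  open ≡-Reasoning
  p : ∀ a ε m → a ℕ.* (ε ℕ.* m) ≡ ε ℕ.* (a ℕ.* m)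
  p = ℕ.solve-∀
  q : ∀ a s b n → a ℕ.* s ℕ.* (b ℕ.* n) ≡ b ℕ.* a ℕ.* (s ℕ.* n)
  q = ℕ.solve-∀
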